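{- Let $s,t$ be integers with $s=3^as'$ and $t=3^bt'$, where $a,b$ are positive integers, $s',t'$ are integers with $3\nmid s't'$, and $b=2a-1$. Let $(P_n)_{n\ge1}$ be the sequence of Lucas atoms associated with $(s,t)$. Then for each $n\ge 2$, \[ v_3(P_n)=\begin{cases} a & \text{if } n=2,\\ b+1+v_3(s'^2+t') & \text{if } n=6,\\ 3^{h-1}b+1 & \text{if } n=2\cdot 3^h \text{ for some integer } h\ge 2,\\ b\,\dfrac{\varphi(n)}{2} & \text{otherwise.}\end{cases} \]
   Context: Lucas atoms: for $n\ge 1$ let $\Phi_n(\alpha,\beta)=\prod_{1\le j\le n,\ \gcd(j,n)=1}(\alpha-\omega^j\beta)$, with $\omega$ a primitive $n$-th root of unity (the homogenization of the $n$-th cyclotomic polynomial). Put $P_1(s,t)=1$, and for $n\ge 2$ let $P_n(s,t)\in\mathbb Z[s,t]$ be the unique polynomial with $P_n(\alpha+\beta,-\alpha\beta)=\Phi_n(\alpha,\beta)$ as polynomials in the variables $\alpha,\beta$. For integers $s,t$, $P_n$ denotes the integer value $P_n(s,t)$. $v_3$ is the $3$-adic valuation, with $v_3(0)=+\infty$; $\varphi$ is Euler's totient function. -}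

module Defs where

open import Algebra.Apartness.Bundles using (HeytingField)
open import Algebra.Bundles.Raw using (RawRing)
import Algebra.Definitions.RawSemiring as RawSemiringDefinitions
open import Data.Integer.Base using (ℤ; +_; -[1+_]; ∣_∣; +-*-rawRing)
open import Data.List.Base using (List; []; _∷_; map; filter; foldr; length; upTo)
open import Data.Nat.Base using (ℕ; zero; suc; _+_; _^_; _≤_; _<_)
open import Data.Nat.Divisibility using (_∣?_)
open import Data.Nat.GCD using (gcd)
import Data.Nat.Properties as ℕₚ
open import Data.Product.Base using (_×_)
open import Function.Base using (id; _∘_)
open import Level using (Level; 0ℓ)
open import Relation.Nullary.Construct.Add.Supremum using (_⁺; ⊤⁺; [_])
open import Relation.Nullary.Decidable.Core using (yes; no)
open import Relation.Nullary.Negation.Core using (¬_)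

private
  variable
    c c′ ℓ′ ℓ₁ ℓ₂ : Level

coprimesUpTo : ℕ → List ℕ
coprimesUpTo n = filter (λ j → gcd j n ℕₚ.≟ 1) (map suc (upTo n))

φ : ℕ → ℕ
φ n = length (coprimesUpTo n)

largestExponent : ℕ → ℕ → ℕ → ℕ
largestExponent p m zero = 0
largestExponent p m (suc k) with (p ^ suc k) ∣? m
... | yes _ = suc k
... | no  _ = largestExponent p m k

-- For m ≠ 0, 3 ^ k ∣ m forces k < 3 ^ k ≤ m, so searching the exponents
-- k ≤ m finds the largest one.
v₃ : ℤ → ℕ ⁺
v₃ x with ∣ x ∣
... | zero  = ⊤⁺
... | suc m = [ largestExponent 3 (suc m) (suc m) ]

infixr 6 _+⁺_

_+⁺_ : ℕ → ℕ ⁺ → ℕ ⁺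
k +⁺ [ m ] = [ k + m ]
k +⁺ ⊤⁺    = ⊤⁺

-- Univariate polynomials as coefficient lists, constant term first.
-- Trailing zeros are allowed; equality compares all coefficients.
module Polynomial {c ℓ} (R : RawRing c ℓ) where
  private module R = RawRing R

  coeff : List R.Carrier → ℕ → R.Carrier
  coeff []      _       = R.0#
  coeff (a ∷ p) zero    = a
  coeff (a ∷ p) (suc i) = coeff p i

  add : List R.Carrier → List R.Carrier → List R.Carrier
  add []      q       = q
  add (a ∷ p) []      = a ∷ p
  add (a ∷ p) (b ∷ q) = (a R.+ b) ∷ add p q

  mul : List R.Carrier → List R.Carrier → List R.Carrier
  mul []      q = []
  mul (a ∷ p) q = add (map (a R.*_) q) (R.0# ∷ mul p q)

  const : R.Carrier → List R.Carrier
  const a = a ∷ []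

  X : List R.Carrier
  X = R.0# ∷ R.1# ∷ []

  rawRing : RawRing c ℓ
  rawRing = record
    { Carrier = List R.Carrier
    ; _≈_     = λ p q → ∀ i → coeff p i R.≈ coeff q i
    ; _+_     = add
    ; _*_     = mul
    ; -_      = map R.-_
    ; 0#      = []
    ; 1#      = const R.1#
    }

-- The polynomial ring R[X][Y].
module Bivariate {c ℓ} (R : RawRing c ℓ) where
  private
    module R[X] = Polynomial R
    module R[X][Y] = Polynomial R[X].rawRing

  rawRing : RawRing c ℓ
  rawRing = R[X][Y].rawRing

  const : RawRing.Carrier R → RawRing.Carrier rawRing
  const = R[X][Y].const ∘ R[X].const

  X Y : RawRing.Carrier rawRing
  X = R[X][Y].const R[X].X
  Y = R[X][Y].X

module _ {A : Set c} (S : RawRing c′ ℓ′) where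
  private module S = RawRing S

  evaluate : (A → S.Carrier) → List A → S.Carrier → S.Carrier
  evaluate f p x = foldr (λ a r → f a S.+ x S.* r) S.0# p

  evaluate₂ : (A → S.Carrier) → List (List A) → S.Carrier → S.Carrier → S.Carrier
  evaluate₂ f p x y = foldr (λ q r → evaluate f q x S.+ y S.* r) S.0# p

ℤ[s,t] : RawRing 0ℓ 0ℓ
ℤ[s,t] = Bivariate.rawRing +-*-rawRing

_⟨_,_⟩ : RawRing.Carrier ℤ[s,t] → ℤ → ℤ → ℤ
P ⟨ s , t ⟩ = evaluate₂ +-*-rawRing id P s t

-- HeytingField is the library's notion of field.  With x # y taken to be
-- ¬ x ≈ y it covers discrete fields; it does not itself demand 0 ≉ 1, but
-- CharacteristicZero does.
module _ (K : HeytingField c ℓ₁ ℓ₂) where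
  open HeytingField K using (Carrier; _≈_; 0#; 1#)

  private
    rawRingK : RawRing c ℓ₁
    rawRingK = record
      { Carrier = Carrier
      ; _≈_     = _≈_
      ; _+_     = HeytingField._+_ K
      ; _*_     = HeytingField._*_ K
      ; -_      = HeytingField.-_ K
      ; 0#      = 0#
      ; 1#      = 1#
      }

    open RawSemiringDefinitions (RawRing.rawSemiring rawRingK)
      renaming (_×_ to _·_; _^_ to _^ᴷ_)

  CharacteristicZero : Set ℓ₁
  CharacteristicZero = ∀ n → 1 ≤ n → ¬ (n · 1# ≈ 0#)

  IsPrimitiveRoot : ℕ → Carrier → Set ℓ₁
  IsPrimitiveRoot n ω = ω ^ᴷ n ≈ 1# × (∀ k → 1 ≤ k → k < n → ¬ (ω ^ᴷ k ≈ 1#))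

  fromℤ : ℤ → Carrier
  fromℤ (+ n)    = n · 1#
  fromℤ -[1+ n ] = HeytingField.-_ K (suc n · 1#)

  K[α,β] : RawRing c ℓ₁
  K[α,β] = Bivariate.rawRing rawRingK

  private
    module B = RawRing K[α,β]
    open Bivariate rawRingK using (const) renaming (X to α; Y to β)

  Φ : ℕ → Carrier → B.Carrier
  Φ n ω = foldr B._*_ B.1# (map factor (coprimesUpTo n))
    where
    factor : ℕ → B.Carrier
    factor j = α B.+ B.- (const (ω ^ᴷ j) B.* β)

  -- The polynomial P(α + β, −αβ).
  substituted : RawRing.Carrier ℤ[s,t] → B.Carrier
  substituted P = evaluate₂ K[α,β] (const ∘ fromℤ) P (α B.+ β) (B.- (α B.* β))

  -- ω n is the primitive n-th root of unity used to form the n-th product.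
  -- The equation determines P n up to equality in ℤ[s,t].
  record IsLucasAtoms (ω : ℕ → Carrier)
                      (P : ℕ → RawRing.Carrier ℤ[s,t]) : Set ℓ₁ where
    field
      one  : RawRing._≈_ ℤ[s,t] (P 1) (RawRing.1# ℤ[s,t])
      atom : ∀ n → 2 ≤ n → substituted (P n) B.≈ Φ n (ω n)

{-# OPTIONS --safe #-}
module Submission where

open import Defs
open import Algebra.Apartness.Bundles using (HeytingField; HeytingCommutativeRing)
open import Algebra.Bundles using (CommutativeRing)
open import Algebra.Bundles.Raw using (RawRing)
open import Algebra.Morphism.Structures using (module RingMorphisms)
import Algebra.Properties.CommutativeSemigroup as CommutativeSemigroupProperties
import Algebra.Properties.CommutativeSemiring.Exp as Exp
import Algebra.Properties.Ring as RingProperties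
import Algebra.Properties.Semiring.Mult as SemiringMult
import Algebra.Solver.Ring as RingSolver
open import Algebra.Solver.Ring.AlmostCommutativeRing
  using (fromCommutativeRing; _-Raw-AlmostCommutative⟶_)
import Data.Integer.Base as ℤ
open import Data.Integer.Base using (ℤ; +_; -[1+_]; +-*-rawRing)
open import Data.Integer.Divisibility using (_∣_)
import Data.Integer.Divisibility.Signed as ∣ℤ
open ∣ℤ using (divides) renaming (_∣_ to _∣ˢ_)
import Data.Integer.Properties as ℤₚ
import Data.Integer.Solver as ℤSolver
open import Data.List.Base
  using (List; []; _∷_; _++_; applyUpTo; filter; foldr; length; map; replicate; upTo)
import Data.List.Properties as Listₚ
open import Data.List.Relation.Unary.All as All using (All; []; _∷_)
import Data.List.Relation.Unary.All.Properties as Allₚ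
open import Data.List.Relation.Unary.AllPairs as AllPairs using (AllPairs; []; _∷_)
import Data.List.Relation.Unary.AllPairs.Properties as AllPairsₚ
open import Data.Maybe.Base using (Maybe; just; nothing)
open import Data.Nat.Base as ℕ using (ℕ; zero; suc; s≤s; z≤n)
import Data.Nat.Coprimality as Coprimality
import Data.Nat.Divisibility as ∣ℕ
open import Data.Nat.DivMod using (m≡m%n+[m/n]*n; m%n<n; m*n/n≡m)
open import Data.Nat.GCD using (gcd)
open import Data.Nat.Induction using (<-rec)
open import Data.Nat.Primality using (Prime; prime?; euclidsLemma)
import Data.Nat.Properties as ℕₚ
open import Data.Product.Base using (_×_; _,_; ∃-syntax; proj₁; proj₂)
open import Data.Sign.Base using (Sign)
open import Data.Sum.Base using (_⊎_; inj₁; inj₂)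
open import Data.Unit.Base using (⊤; tt)
open import Function.Base using (id; _∘_)
open import Level using (Level)
open import Relation.Binary.PropositionalEquality.Core as ≡ using (_≡_; _≢_)
open import Relation.Binary.PropositionalEquality.Properties using (module ≡-Reasoning)
import Relation.Binary.Reasoning.Setoid as SetoidReasoning
open import Relation.Nullary.Construct.Add.Supremum using ([_])
open import Relation.Nullary.Decidable.Core using (yes; no; from-yes)
open import Relation.Nullary.Negation.Core using (¬_; contradiction)
open import Relation.Unary using (Decidable)

-- Write f for Pₙ, so that f (x + y , − x y) = ∏ (x − ωʲ y) for all integers x, y.
-- The right-hand side is homogeneous of degree φ n, which forces f to be isobaric:
-- f = Σ cᵢ s ^ (φ n − 2 i) tⁱ.  As s² = 3ᵇ · 3 s′² and t = 3ᵇ t′, the sum is dominated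
-- by its last term, and v₃ f = b φ(n) / 2 as soon as φ n is even and 3 ∤ c_{φ(n)/2};
-- both follow from 3 ∤ f (3 , −2) = Φₙ(2 , 1).
--
-- The integer polynomial Φₙ(X , 1) is monic with distinct roots, so by long division it
-- divides (Xⁿ − 1) / (Xᵏ − 1) over ℤ for every proper divisor k of n, and at X = 2 this
-- quotient is prime to 3 for a suitable k unless n = 2 · 3ʰ.  In that exceptional case
-- Φₙ(x , y) = Φ₆(x ^ 3ᵏ , y ^ 3ᵏ) with k = h − 1, so f is obtained from s² + 3 t by iterating
-- (s , t) ↦ (s³ + 3 s t , t³), and the valuation can be followed along the iteration.

-- For given integers s, t the field `K` need not contain α, β with α + β = s and - α β = t, so Pₙ(s
-- , t) cannot be read off the product. The product only gives the values at points (s , y (y - s));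
-- for fixed s both sides of a claimed identity are polynomials in t, and infinitely many such
-- points settle it for all integers t. Polynomial identities are obtained through values in this
-- way, and characteristic zero carries them from `K` back to ℤ.
--
-- The point (3 , -2) isolates the last coefficient: 3 divides the first coordinate but not the
-- second, so modulo 3 only the pure power of t survives. As 2 ≡ -1 modulo 3, the question is
-- whether -1 is a root of Φₙ modulo 3; since -1 has order 2 there, only n = 2 · 3ʰ can be affected.
--
-- In that family b = 2 a - 1 gives s² and 3 t the same valuation b + 1, so their sum may cancel
-- further: this is the term v₃(s′² + t′). One step of the iteration puts extra factors of 3 into
-- σ², after which 3 τ dominates and no cancellation is left.

-- Evaluation of coefficient lists and its naturality.

IsHomomorphism : ∀ {r ℓr c ℓ} (R : RawRing r ℓr) (S : CommutativeRing c ℓ) →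
                 (RawRing.Carrier R → CommutativeRing.Carrier S) → Set _
IsHomomorphism R S = RingMorphisms.IsRingHomomorphism R (CommutativeRing.rawRing S)

module _ {r ℓr c ℓ : Level} (R : RawRing r ℓr) (S : CommutativeRing c ℓ)
         (f : RawRing.Carrier R → CommutativeRing.Carrier S) where
  private
    module R = RawRing R
    module S = CommutativeRing S

  mkIsHomomorphism : (∀ {a b} → a R.≈ b → f a S.≈ f b) →
    (∀ a b → f (a R.+ b) S.≈ f a S.+ f b) → (∀ a b → f (a R.* b) S.≈ f a S.* f b) →
    (∀ a → f (R.- a) S.≈ S.- f a) → f R.0# S.≈ S.0# → f R.1# S.≈ S.1# → IsHomomorphism R S f
  mkIsHomomorphism cong add mul neg 0-homo 1-homo = record
    { isSemiringHomomorphism = record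
      { isNearSemiringHomomorphism = record
        { +-isMonoidHomomorphism = record
          { isMagmaHomomorphism = record
            { isRelHomomorphism = record { cong = cong } ; homo = add }
          ; ε-homo = 0-homo }
        ; *-homo = mul }
      ; 1#-homo = 1-homo }
    ; -‿homo = neg }

module Evaluation {r ℓr c ℓ : Level} (R : RawRing r ℓr) (S : CommutativeRing c ℓ)
                  (f : RawRing.Carrier R → CommutativeRing.Carrier S)
                  (f-hom : IsHomomorphism R S f) (x : CommutativeRing.Carrier S) where
  private
    module R = RawRing R
    module P = Polynomial R
  open CommutativeRing S hiding (zero)
  open RingProperties ring using (-‿distribʳ-*; -‿+-comm; -0#≈0#)
  open Exp commutativeSemiring using (_^_)
  open RingMorphisms.IsRingHomomorphism f-hom
  open SetoidReasoning setoid

  eval : List R.Carrier → Carrier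
  eval p = evaluate rawRing f p x

  eval-zero : ∀ p → (∀ i → f (P.coeff p i) ≈ 0#) → eval p ≈ 0#
  eval-zero []      p≈0 = refl
  eval-zero (a ∷ p) p≈0 = begin
    f a + x * eval p  ≈⟨ +-cong (p≈0 0) (*-congˡ (eval-zero p (p≈0 ∘ suc))) ⟩
    0# + x * 0#       ≈⟨ trans (+-identityˡ _) (zeroʳ x) ⟩
    0#                ∎

  -- Coefficients are compared after applying `f`: `R` is only a raw ring, and its own equality
  -- offers neither symmetry nor transitivity.
  eval-cong : ∀ p q → (∀ i → f (P.coeff p i) ≈ f (P.coeff q i)) → eval p ≈ eval q
  eval-cong []      q       p≈q = sym (eval-zero q λ i → trans (sym (p≈q i)) 0#-homo)
  eval-cong (a ∷ p) []      p≈q = eval-zero (a ∷ p) λ i → trans (p≈q i) 0#-homo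
  eval-cong (a ∷ p) (b ∷ q) p≈q = +-cong (p≈q 0) (*-congˡ (eval-cong p q (p≈q ∘ suc)))

  eval-const : ∀ a → eval (P.const a) ≈ f a
  eval-const a = trans (+-congˡ (zeroʳ x)) (+-identityʳ (f a))

  eval-X : eval P.X ≈ x
  eval-X = begin
    f R.0# + x * eval (P.const R.1#) ≈⟨ +-cong 0#-homo (*-congˡ (trans (eval-const R.1#) 1#-homo)) ⟩
    0# + x * 1#                      ≈⟨ trans (+-identityˡ _) (*-identityʳ x) ⟩
    x                                ∎

  eval-add : ∀ p q → eval (P.add p q) ≈ eval p + eval q
  eval-add []      q       = sym (+-identityˡ (eval q))
  eval-add (a ∷ p) []      = sym (+-identityʳ (eval (a ∷ p)))
  eval-add (a ∷ p) (b ∷ q) = begin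
    f (a R.+ b) + x * eval (P.add p q)          ≈⟨ +-cong (+-homo a b) (*-congˡ (eval-add p q)) ⟩
    (f a + f b) + x * (eval p + eval q)         ≈⟨ +-congˡ (distribˡ x _ _) ⟩
    (f a + f b) + (x * eval p + x * eval q)     ≈⟨ interchange _ _ _ _ ⟩
    (f a + x * eval p) + (f b + x * eval q)     ∎
    where open CommutativeSemigroupProperties +-commutativeSemigroup using (interchange)

  eval-scale : ∀ a q → eval (map (a R.*_) q) ≈ f a * eval q
  eval-scale a []      = sym (zeroʳ (f a))
  eval-scale a (b ∷ q) = begin
    f (a R.* b) + x * eval (map (a R.*_) q)  ≈⟨ +-cong (*-homo a b) (*-congˡ (eval-scale a q)) ⟩
    f a * f b + x * (f a * eval q)           ≈⟨ +-congˡ (x∙yz≈y∙xz x (f a) (eval q)) ⟩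
    f a * f b + f a * (x * eval q)           ≈⟨ distribˡ (f a) _ _ ⟨
    f a * (f b + x * eval q)                 ∎
    where open CommutativeSemigroupProperties *-commutativeSemigroup using (x∙yz≈y∙xz)

  eval-mul : ∀ p q → eval (P.mul p q) ≈ eval p * eval q
  eval-mul []      q = sym (zeroˡ (eval q))
  eval-mul (a ∷ p) q = begin
    eval (P.add (map (a R.*_) q) (R.0# ∷ P.mul p q))  ≈⟨ eval-add (map (a R.*_) q) _ ⟩
    eval (map (a R.*_) q) + (f R.0# + x * eval (P.mul p q))
      ≈⟨ +-cong (eval-scale a q) (trans (+-congʳ 0#-homo) (+-identityˡ _)) ⟩
    f a * eval q + x * eval (P.mul p q)               ≈⟨ +-congˡ (*-congˡ (eval-mul p q)) ⟩
    f a * eval q + x * (eval p * eval q)              ≈⟨ +-congˡ (*-assoc x _ _) ⟨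
    f a * eval q + (x * eval p) * eval q              ≈⟨ distribʳ (eval q) _ _ ⟨
    (f a + x * eval p) * eval q                       ∎

  eval-neg : ∀ p → eval (map R.-_ p) ≈ - eval p
  eval-neg []      = sym -0#≈0#
  eval-neg (a ∷ p) = begin
    f (R.- a) + x * eval (map R.-_ p)  ≈⟨ +-cong (-‿homo a) (*-congˡ (eval-neg p)) ⟩
    - f a + x * (- eval p)             ≈⟨ +-congˡ (-‿distribʳ-* x _) ⟨
    - f a + - (x * eval p)             ≈⟨ -‿+-comm (f a) _ ⟩
    - (f a + x * eval p)               ∎

  eval-shift : ∀ k p → eval (replicate k R.0# ++ p) ≈ x ^ k * eval p
  eval-shift zero    p = sym (*-identityˡ (eval p))
  eval-shift (suc k) p = begin
    f R.0# + x * eval (replicate k R.0# ++ p)  ≈⟨ +-cong 0#-homo (*-congˡ (eval-shift k p)) ⟩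
    0# + x * (x ^ k * eval p)                  ≈⟨ +-identityˡ _ ⟩
    x * (x ^ k * eval p)                       ≈⟨ *-assoc x _ _ ⟨
    x * x ^ k * eval p                         ∎

  eval-isHomomorphism : IsHomomorphism P.rawRing S eval
  eval-isHomomorphism = mkIsHomomorphism P.rawRing S eval
    (λ {p} {q} p≈q → eval-cong p q (λ i → ⟦⟧-cong (p≈q i)))
    eval-add eval-mul eval-neg refl (trans (eval-const R.1#) 1#-homo)

module _ {a b ℓb c ℓ : Level} {A : Set a} (B : RawRing b ℓb) (S : CommutativeRing c ℓ)
         (h : RawRing.Carrier B → CommutativeRing.Carrier S) (h-hom : IsHomomorphism B S h) where
  private module B = RawRing B
  open CommutativeRing S hiding (zero)
  open RingMorphisms.IsRingHomomorphism h-hom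

  evaluate-natural : (g : A → B.Carrier) (f : A → Carrier) → (∀ a → h (g a) ≈ f a) →
    ∀ p {u x} → h u ≈ x → h (evaluate B g p u) ≈ evaluate rawRing f p x
  evaluate-natural g f hg≈f []      hu≈x = 0#-homo
  evaluate-natural g f hg≈f (a ∷ p) hu≈x = trans (+-homo _ _)
    (+-cong (hg≈f a) (trans (*-homo _ _) (*-cong hu≈x (evaluate-natural g f hg≈f p hu≈x))))

  evaluate₂-natural : (g : A → B.Carrier) (f : A → Carrier) → (∀ a → h (g a) ≈ f a) →
    ∀ p {u v x y} → h u ≈ x → h v ≈ y → h (evaluate₂ B g p u v) ≈ evaluate₂ rawRing f p x y
  evaluate₂-natural g f hg≈f []      hu≈x hv≈y = 0#-homo
  evaluate₂-natural g f hg≈f (q ∷ p) hu≈x hv≈y = trans (+-homo _ _)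
    (+-cong (evaluate-natural g f hg≈f q hu≈x)
            (trans (*-homo _ _) (*-cong hv≈y (evaluate₂-natural g f hg≈f p hu≈x hv≈y))))

  product-natural : (g : A → B.Carrier) (f : A → Carrier) → (∀ a → h (g a) ≈ f a) →
    ∀ as → h (foldr B._*_ B.1# (map g as)) ≈ foldr _*_ 1# (map f as)
  product-natural g f hg≈f []       = 1#-homo
  product-natural g f hg≈f (a ∷ as) = trans (*-homo _ _) (*-cong (hg≈f a) (product-natural g f hg≈f as))

-- The integers inside the field, and cancellation without decidable equality.

module _ {c ℓ₁ ℓ₂ : Level} (K : HeytingField c ℓ₁ ℓ₂) where
  private module K = HeytingField K

  commutativeRing : CommutativeRing c ℓ₁
  commutativeRing = HeytingCommutativeRing.commutativeRing K.heytingCommutativeRing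

  open CommutativeRing commutativeRing hiding (zero)
  open RingProperties ring
  open SemiringMult semiring using (×-homo-+; ×1-homo-*) renaming (_×_ to _·_)
  open SetoidReasoning setoid

  ι : ℤ → Carrier
  ι = fromℤ K

  ι-⊖ : ∀ m n → ι (m ℤ.⊖ n) ≈ m · 1# - n · 1#
  ι-⊖ m       zero    = sym (trans (+-congˡ -0#≈0#) (+-identityʳ _))
  ι-⊖ zero    (suc n) = sym (+-identityˡ _)
  ι-⊖ (suc m) (suc n) = begin
    ι (suc m ℤ.⊖ suc n)                        ≡⟨ ≡.cong ι (ℤₚ.[1+m]⊖[1+n]≡m⊖n m n) ⟩
    ι (m ℤ.⊖ n)                                ≈⟨ ι-⊖ m n ⟩
    m · 1# - n · 1#                            ≈⟨ +-identityˡ _ ⟨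
    0# + (m · 1# - n · 1#)                     ≈⟨ +-congʳ (-‿inverseʳ 1#) ⟨
    (1# - 1#) + (m · 1# - n · 1#)              ≈⟨ interchange 1# (- 1#) _ _ ⟩
    (1# + m · 1#) + (- 1# + - (n · 1#))        ≈⟨ +-congˡ (-‿+-comm 1# _) ⟩
    suc m · 1# - suc n · 1#                    ∎
    where open CommutativeSemigroupProperties +-commutativeSemigroup using (interchange)

  ι-+ : ∀ i j → ι (i ℤ.+ j) ≈ ι i + ι j
  ι-+ (+ m)    (+ n)    = ×-homo-+ 1# m n
  ι-+ (+ m)    -[1+ n ] = ι-⊖ m (suc n)
  ι-+ -[1+ m ] (+ n)    = trans (ι-⊖ n (suc m)) (+-comm _ _)
  ι-+ -[1+ m ] -[1+ n ] = begin
    - (suc (suc (m ℕ.+ n)) · 1#)   ≡⟨ ≡.cong (λ k → - (k · 1#)) (≡.sym (ℕₚ.+-suc (suc m) n)) ⟩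
    - ((suc m ℕ.+ suc n) · 1#)     ≈⟨ -‿cong (×-homo-+ 1# (suc m) (suc n)) ⟩
    - (suc m · 1# + suc n · 1#)                ≈⟨ -‿+-comm _ _ ⟨
    - (suc m · 1#) - suc n · 1#                ∎

  ι-neg : ∀ i → ι (ℤ.- i) ≈ - ι i
  ι-neg (+ zero)  = sym -0#≈0#
  ι-neg (+ suc n) = refl
  ι-neg -[1+ n ]  = sym (-‿involutive _)

  ι-* : ∀ i j → ι (i ℤ.* j) ≈ ι i * ι j
  ι-* (+ m) (+ n) = trans (reflexive (≡.cong ι (ℤₚ.+◃n≡+n (m ℕ.* n)))) (×1-homo-* m n)
  ι-* (+ m) -[1+ n ] = begin
    ι (Sign.- ℤ.◃ (m ℕ.* suc n))  ≡⟨ ≡.cong ι (ℤₚ.-◃n≡-n (m ℕ.* suc n)) ⟩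
    ι (ℤ.- (+ (m ℕ.* suc n)))     ≈⟨ ι-neg (+ (m ℕ.* suc n)) ⟩
    - ((m ℕ.* suc n) · 1#)        ≈⟨ -‿cong (×1-homo-* m (suc n)) ⟩
    - (m · 1# * (suc n · 1#))                 ≈⟨ -‿distribʳ-* _ _ ⟩
    m · 1# * - (suc n · 1#)                   ∎
  ι-* -[1+ m ] (+ n) = begin
    ι (Sign.- ℤ.◃ (suc m ℕ.* n))  ≡⟨ ≡.cong ι (ℤₚ.-◃n≡-n (suc m ℕ.* n)) ⟩
    ι (ℤ.- (+ (suc m ℕ.* n)))     ≈⟨ ι-neg (+ (suc m ℕ.* n)) ⟩
    - ((suc m ℕ.* n) · 1#)        ≈⟨ -‿cong (×1-homo-* (suc m) n) ⟩
    - (suc m · 1# * (n · 1#))                 ≈⟨ -‿distribˡ-* _ _ ⟩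
    - (suc m · 1#) * (n · 1#)                 ∎
  ι-* -[1+ m ] -[1+ n ] = begin
    ι (Sign.+ ℤ.◃ (suc m ℕ.* suc n)) ≈⟨ reflexive (≡.cong ι (ℤₚ.+◃n≡+n (suc m ℕ.* suc n))) ⟩
    (suc m ℕ.* suc n) · 1#           ≈⟨ ×1-homo-* (suc m) (suc n) ⟩
    suc m · 1# * (suc n · 1#)                    ≈⟨ -‿involutive _ ⟨
    - - (suc m · 1# * (suc n · 1#))              ≈⟨ -‿cong (-‿distribʳ-* _ _) ⟩
    - (suc m · 1# * - (suc n · 1#))              ≈⟨ -‿distribˡ-* _ _ ⟩
    - (suc m · 1#) * - (suc n · 1#)              ∎

  ι-isHomomorphism : IsHomomorphism +-*-rawRing commutativeRing ι
  ι-isHomomorphism = mkIsHomomorphism +-*-rawRing commutativeRing ι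
    (λ i≡j → reflexive (≡.cong ι i≡j)) ι-+ ι-* ι-neg refl (+-identityʳ 1#)

  ι-morphism : +-*-rawRing -Raw-AlmostCommutative⟶ fromCommutativeRing commutativeRing
  ι-morphism = record
    { ⟦_⟧ = ι ; +-homo = ι-+ ; *-homo = ι-* ; -‿homo = ι-neg ; 0-homo = refl ; 1-homo = +-identityʳ 1# }

  _ι≟_ : ∀ i j → Maybe (ι i ≈ ι j)
  i ι≟ j with i ℤₚ.≟ j
  ... | yes i≡j = just (reflexive (≡.cong ι i≡j))
  ... | no  _   = nothing

  module Solver = RingSolver +-*-rawRing (fromCommutativeRing commutativeRing) ι-morphism _ι≟_

  -- Tightness makes equality the negation of apartness, hence stable; this allows proofs of
  -- equations by contradiction.
  ≈-stable : ∀ {x y} → ¬ ¬ x ≈ y → x ≈ y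
  ≈-stable {x} {y} ¬¬x≈y = proj₁ (K.tight x y) λ x#y → ¬¬x≈y λ x≈y → K.#-irrefl x≈y x#y

  -- Inverting x needs apartness from 0, while only ¬ x ≈ 0 is given. If y were nonzero, x could not
  -- be apart from 0, so x ≈ 0 by tightness, a contradiction; stability then gives y ≈ 0.
  x*y≈0⇒y≈0 : ∀ {x y} → ¬ x ≈ 0# → x * y ≈ 0# → y ≈ 0#
  x*y≈0⇒y≈0 {x} {y} x≉0 xy≈0 = ≈-stable λ y≉0 → x≉0 (proj₁ (K.tight x 0#) λ x#0 → y≉0 (cancel x#0))
    where
    cancel : x K.# 0# → y ≈ 0#
    cancel x#0 with K.#⇒invertible x#0
    ... | z , z[x-0]≈1 , _ = begin
      y                 ≈⟨ *-identityˡ y ⟨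
      1# * y            ≈⟨ *-congʳ z[x-0]≈1 ⟨
      z * (x - 0#) * y  ≈⟨ *-congʳ (*-congˡ (trans (+-congˡ -0#≈0#) (+-identityʳ x))) ⟩
      z * x * y         ≈⟨ *-assoc z x y ⟩
      z * (x * y)       ≈⟨ *-congˡ xy≈0 ⟩
      z * 0#            ≈⟨ zeroʳ z ⟩
      0#                ∎

ℤ-ring : CommutativeRing _ _
ℤ-ring = ℤₚ.+-*-commutativeRing

id-isHomomorphism : ∀ {c ℓ} (S : CommutativeRing c ℓ) → IsHomomorphism (CommutativeRing.rawRing S) S id
id-isHomomorphism S = mkIsHomomorphism (CommutativeRing.rawRing S) S id
  id (λ _ _ → refl) (λ _ _ → refl) (λ _ → refl) refl refl
  where open CommutativeRing S using (refl)

-- Distinct integers of the form y (y − s): since s = (s − y) + y, the points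
-- (s , y (y − s)) lie on the image of (x , y) ↦ (x + y , − x y).
module _ (s : ℤ) where
  ordinate : ℕ → ℤ
  ordinate k = + suc (ℤ.∣ s ∣ ℕ.+ k)

  sample : ℕ → ℤ
  sample k = ordinate k ℤ.* (ordinate k ℤ.- s)

  -- The difference of two samples factors as (u - v) (u + v - s), and u + v exceeds the absolute
  -- value of s.
  sample-injective : ∀ {i j} → sample i ≡ sample j → i ≡ j
  sample-injective {i} {j} eq with ℤₚ.i*j≡0⇒i≡0∨j≡0 (ordinate i ℤ.- ordinate j) factored
    where
    open ℤSolver.+-*-Solver
    factored : (ordinate i ℤ.- ordinate j) ℤ.* (ordinate i ℤ.+ ordinate j ℤ.- s) ≡ ℤ.0ℤ
    factored = ≡.trans
      (solve 3 (λ u v s → (u :- v) :* (u :+ v :- s) := u :* (u :- s) :- v :* (v :- s)) ≡.refl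
        (ordinate i) (ordinate j) s)
      (ℤₚ.i≡j⇒i-j≡0 eq)
  ... | inj₁ eq′ = ℕₚ.+-cancelˡ-≡ ℤ.∣ s ∣ i j
    (ℕₚ.suc-injective (ℤₚ.+-injective (ℤₚ.i-j≡0⇒i≡j (ordinate i) (ordinate j) eq′)))
  ... | inj₂ eq′ = contradiction
    (≡.sym (≡.cong ℤ.∣_∣ (ℤₚ.i-j≡0⇒i≡j (ordinate i ℤ.+ ordinate j) s eq′)))
    (ℕₚ.<⇒≢ (s≤s (ℕₚ.≤-trans (ℕₚ.m≤m+n ℤ.∣ s ∣ i) (ℕₚ.m≤m+n _ _))))

-- Root counting over the field, and monic long division over ℤ.

module Roots {c ℓ₁ ℓ₂ : Level} (K : HeytingField c ℓ₁ ℓ₂) (char0 : CharacteristicZero K) where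
  open CommutativeRing (commutativeRing K) hiding (zero)
  open RingProperties ring
  open Exp commutativeSemiring using (_^_)
  open Solver K using (solve; _:=_; _:+_; _:*_; _:-_; :-_; con)
  open SetoidReasoning setoid
  private
    module P = Polynomial rawRing
    module Pℤ = Polynomial +-*-rawRing
    module E = Evaluation rawRing (commutativeRing K) id (id-isHomomorphism (commutativeRing K))
    module Eℤ = Evaluation +-*-rawRing (commutativeRing K) (ι K) (ι-isHomomorphism K)

  ⟦_⟧ : List Carrier → Carrier → Carrier
  ⟦ p ⟧ x = evaluate rawRing id p x

  ⟦_⟧ℤ : List ℤ → Carrier → Carrier
  ⟦ p ⟧ℤ x = evaluate rawRing (ι K) p x

  x-y≈0⇒x≈y : ∀ {x y} → x - y ≈ 0# → x ≈ y
  x-y≈0⇒x≈y {x} {y} x-y≈0 = begin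
    x           ≈⟨ solve 2 (λ x y → x := (x :- y) :+ y) refl x y ⟩
    (x - y) + y ≈⟨ +-congʳ x-y≈0 ⟩
    0# + y      ≈⟨ +-identityˡ y ⟩
    y           ∎

  x≈y⇒x-y≈0 : ∀ {x y} → x ≈ y → x - y ≈ 0#
  x≈y⇒x-y≈0 x≈y = trans (+-congʳ x≈y) (-‿inverseʳ _)

  x*x′≈0 : ∀ {x} x′ → x ≈ 0# → x * x′ ≈ 0#
  x*x′≈0 x′ x≈0 = trans (*-congʳ x≈0) (zeroˡ x′)

  ι-injective₀ : ∀ i → ι K i ≈ 0# → i ≡ ℤ.0ℤ
  ι-injective₀ (+ zero)  ιi≈0 = ≡.refl
  ι-injective₀ (+ suc n) ιi≈0 = contradiction ιi≈0 (char0 (suc n) (s≤s z≤n))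
  ι-injective₀ -[1+ n ]  ιi≈0 = contradiction
    (trans (sym (-‿involutive _)) (trans (-‿cong ιi≈0) -0#≈0#)) (char0 (suc n) (s≤s z≤n))

  ι-injective : ∀ {i j} → ι K i ≈ ι K j → i ≡ j
  ι-injective {i} {j} eq = ℤₚ.i-j≡0⇒i≡j i j (ι-injective₀ (i ℤ.- j)
    (trans (ι-+ K i (ℤ.- j)) (trans (+-congˡ (ι-neg K j)) (x≈y⇒x-y≈0 eq))))

  ⟦⟧-zero : ∀ {p} → All (_≈ 0#) p → ∀ x → ⟦ p ⟧ x ≈ 0#
  ⟦⟧-zero []          x = refl
  ⟦⟧-zero (a≈0 ∷ p≈0) x = trans (+-cong a≈0 (*-congˡ (⟦⟧-zero p≈0 x))) (trans (+-identityˡ _) (zeroʳ x))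

  ⟦⟧ℤ-map : ∀ p x → ⟦ map (ι K) p ⟧ x ≈ ⟦ p ⟧ℤ x
  ⟦⟧ℤ-map []      x = refl
  ⟦⟧ℤ-map (a ∷ p) x = +-congˡ (*-congˡ (⟦⟧ℤ-map p x))

  ι-evaluate : ∀ p k → ι K (evaluate +-*-rawRing id p k) ≈ ⟦ p ⟧ℤ (ι K k)
  ι-evaluate p k = evaluate-natural +-*-rawRing (commutativeRing K) (ι K) (ι-isHomomorphism K)
    id (ι K) (λ _ → refl) p {u = k} refl

  -- The quotient of a + X p by X − r, which does not depend on a.
  quotient : Carrier → List Carrier → List Carrier
  quotient r []      = []
  quotient r (b ∷ p) = ⟦ b ∷ p ⟧ r ∷ quotient r p

  length-quotient : ∀ r p → length (quotient r p) ≡ length p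
  length-quotient r []      = ≡.refl
  length-quotient r (b ∷ p) = ≡.cong suc (length-quotient r p)

  -- The left side is f (x) - f (r) for every f = a + X p, so this is the factor theorem before f
  -- (r) = 0 is assumed.
  quotient-correct : ∀ r p x → x * ⟦ p ⟧ x - r * ⟦ p ⟧ r ≈ (x - r) * ⟦ quotient r p ⟧ x
  quotient-correct r []      x = trans (+-cong (zeroʳ x) (trans (-‿cong (zeroʳ r)) -0#≈0#))
    (trans (+-identityˡ 0#) (sym (zeroʳ (x - r))))
  quotient-correct r (b ∷ p) x = begin
    x * (b + x * ⟦ p ⟧ x) - r * (b + r * ⟦ p ⟧ r)
      ≈⟨ solve 5 (λ x r b u v → x :* (b :+ x :* u) :- r :* (b :+ r :* v) :=
           x :* (x :* u :- r :* v) :+ (x :- r) :* (b :+ r :* v)) refl x r b (⟦ p ⟧ x) (⟦ p ⟧ r) ⟩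
    x * (x * ⟦ p ⟧ x - r * ⟦ p ⟧ r) + (x - r) * ⟦ b ∷ p ⟧ r
      ≈⟨ +-congʳ (*-congˡ (quotient-correct r p x)) ⟩
    x * ((x - r) * ⟦ quotient r p ⟧ x) + (x - r) * ⟦ b ∷ p ⟧ r
      ≈⟨ solve 4 (λ x y u v → x :* (y :* u) :+ y :* v := y :* (v :+ x :* u)) refl x (x - r) _ _ ⟩
    (x - r) * (⟦ b ∷ p ⟧ r + x * ⟦ quotient r p ⟧ x) ∎

  -- The entries of the quotient are the Horner values at r of the successive tails. When they and f
  -- (r) vanish, each Horner step leaves its coefficient alone, so that is zero too.
  quotient≈0⇒≈0 : ∀ r a p → ⟦ a ∷ p ⟧ r ≈ 0# → All (_≈ 0#) (quotient r p) → All (_≈ 0#) (a ∷ p)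
  quotient≈0⇒≈0 r a [] root [] = trans (sym (trans (+-congˡ (zeroʳ r)) (+-identityʳ a))) root ∷ []
  quotient≈0⇒≈0 r a (b ∷ p) root (root′ ∷ q≈0) =
    trans (sym (trans (+-congˡ (trans (*-congˡ root′) (zeroʳ r))) (+-identityʳ a))) root
    ∷ quotient≈0⇒≈0 r b p root′ q≈0

  -- Division by X - r shortens the list by one and keeps the other roots r′, because r′ - r can be
  -- cancelled. Bounding the length instead of the degree avoids having to recognise zero leading
  -- coefficients.
  roots⇒≈0 : ∀ rs p → length p ℕ.≤ length rs → AllPairs (λ r r′ → ¬ r ≈ r′) rs →
             All (λ r → ⟦ p ⟧ r ≈ 0#) rs → All (_≈ 0#) p
  roots⇒≈0 rs       []      _        _            _            = []
  roots⇒≈0 (r ∷ rs) (a ∷ p) (s≤s le) (r≉rs ∷ rs≉) (root ∷ roots) = quotient≈0⇒≈0 r a p root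
    (roots⇒≈0 rs (quotient r p) (≡.subst (ℕ._≤ length rs) (≡.sym (length-quotient r p)) le) rs≉
      (All.zipWith (λ (r≉r′ , root′) → root-of-quotient r≉r′ root′) (r≉rs , roots)))
    where
    root-of-quotient : ∀ {r′} → ¬ r ≈ r′ → ⟦ a ∷ p ⟧ r′ ≈ 0# → ⟦ quotient r p ⟧ r′ ≈ 0#
    root-of-quotient {r′} r≉r′ root′ = x*y≈0⇒y≈0 K (λ r′-r≈0 → r≉r′ (sym (x-y≈0⇒x≈y r′-r≈0))) (begin
      (r′ - r) * ⟦ quotient r p ⟧ r′     ≈⟨ quotient-correct r p r′ ⟨
      r′ * ⟦ p ⟧ r′ - r * ⟦ p ⟧ r        ≈⟨ solve 3 (λ a u v → u :- v := (a :+ u) :- (a :+ v)) refl a _ _ ⟩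
      ⟦ a ∷ p ⟧ r′ - ⟦ a ∷ p ⟧ r         ≈⟨ x≈y⇒x-y≈0 (trans root′ (sym root)) ⟩
      0#                                 ∎)

  samples⇒≈0 : ∀ s p → (∀ k → ⟦ p ⟧ (ι K (sample s k)) ≈ 0#) → All (_≈ 0#) p
  samples⇒≈0 s p roots = roots⇒≈0 (applyUpTo (ι K ∘ sample s) (length p)) p
    (ℕₚ.≤-reflexive (≡.sym (Listₚ.length-applyUpTo _ (length p))))
    (AllPairsₚ.applyUpTo⁺₁ _ (length p) λ i<j _ eq →
      ℕₚ.<⇒≢ i<j (sample-injective s (ι-injective eq)))
    (Allₚ.applyUpTo⁺₂ _ (length p) roots)

  samples⇒≡0 : ∀ s p → (∀ k → evaluate +-*-rawRing id p (sample s k) ≡ ℤ.0ℤ) → All (_≡ ℤ.0ℤ) p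
  samples⇒≡0 s p roots = All.map (λ {i} → ι-injective₀ i) (Allₚ.map⁻ (samples⇒≈0 s (map (ι K) p) λ k →
    trans (⟦⟧ℤ-map p _) (trans (sym (ι-evaluate p (sample s k))) (reflexive (≡.cong (ι K) (roots k))))))

  linearProduct : List Carrier → Carrier → Carrier
  linearProduct rs x = foldr _*_ 1# (map (λ r → x - r) rs)

  linearProduct-root : ∀ rs → All (λ r → linearProduct rs r ≈ 0#) rs
  linearProduct-root []       = []
  linearProduct-root (r ∷ rs) = x*x′≈0 _ (-‿inverseʳ r) ∷
    All.map (λ root → trans (*-congˡ root) (zeroʳ _)) (linearProduct-root rs)

  monic-eval : ∀ p x → ⟦ p ++ 1# ∷ [] ⟧ x ≈ x ^ length p + ⟦ p ⟧ x
  monic-eval []      x = +-congˡ (zeroʳ x)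
  monic-eval (a ∷ p) x = trans (+-congˡ (*-congˡ (monic-eval p x)))
    (solve 4 (λ a x u v → a :+ x :* (u :+ v) := x :* u :+ (a :+ x :* v)) refl a x _ _)

  length-add : ∀ {r ℓr} (R : RawRing r ℓr) p q → length p ≡ length q → length (Polynomial.add R p q) ≡ length q
  length-add R []      q       eq = ≡.refl
  length-add R (a ∷ p) (b ∷ q) eq = ≡.cong suc (length-add R p q (ℕₚ.suc-injective eq))

  -- The coefficients of ∏ (X - r) below the leading 1. Without that 1 the length equals the number
  -- of roots, so a difference of two monic polynomials is short enough for `roots⇒≈0`.
  expand : List Carrier → List Carrier
  expand []       = []
  expand (r ∷ rs) = P.add (0# ∷ expand rs) (map ((- r) *_) (expand rs ++ 1# ∷ []))

  length-expand : ∀ rs → length (expand rs) ≡ length rs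
  length-expand []       = ≡.refl
  length-expand (r ∷ rs) = ≡.trans
    (length-add rawRing (0# ∷ expand rs) (map ((- r) *_) (expand rs ++ 1# ∷ [])) (≡.sym len))
    (≡.trans len (≡.cong suc (length-expand rs)))
    where
    len : length (map ((- r) *_) (expand rs ++ 1# ∷ [])) ≡ suc (length (expand rs))
    len = ≡.trans (Listₚ.length-map _ (expand rs ++ 1# ∷ []))
      (≡.trans (Listₚ.length-++ (expand rs)) (ℕₚ.+-comm _ 1))

  expand-correct : ∀ rs x → linearProduct rs x ≈ x ^ length rs + ⟦ expand rs ⟧ x
  expand-correct []       x = sym (+-identityʳ 1#)
  expand-correct (r ∷ rs) x = begin
    (x - r) * linearProduct rs x           ≈⟨ *-congˡ (expand-correct rs x) ⟩
    (x - r) * (x ^ length rs + e)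
      ≈⟨ solve 5 (λ x r u e z → (x :- r) :* (u :+ e) := x :* u :+ ((con ℤ.0ℤ :+ x :* e) :+ (:- r) :* (u :+ e)))
           refl x r (x ^ length rs) e 0# ⟩
    x * x ^ length rs + ((0# + x * e) + (- r) * (x ^ length rs + e))
      ≈⟨ +-congˡ (+-congˡ (*-congˡ (trans (monic-eval (expand rs) x)
           (+-congʳ (reflexive (≡.cong (x ^_) (length-expand rs))))))) ⟨
    x * x ^ length rs + ((0# + x * e) + (- r) * ⟦ expand rs ++ 1# ∷ [] ⟧ x)
      ≈⟨ +-congˡ (+-congˡ (E.eval-scale x (- r) (expand rs ++ 1# ∷ []))) ⟨
    x * x ^ length rs + ((0# + x * e) + ⟦ map ((- r) *_) (expand rs ++ 1# ∷ []) ⟧ x)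
      ≈⟨ +-congˡ (E.eval-add x (0# ∷ expand rs) (map ((- r) *_) (expand rs ++ 1# ∷ []))) ⟨
    x * x ^ length rs + ⟦ expand (r ∷ rs) ⟧ x  ∎
    where e = ⟦ expand rs ⟧ x

  -- The leading terms cancel in the difference of the two monic polynomials, which therefore has
  -- more roots than its degree allows.
  monic≈linearProduct : ∀ rs p → length p ℕ.≤ length rs → AllPairs (λ r r′ → ¬ r ≈ r′) rs →
    All (λ r → r ^ length rs + ⟦ p ⟧ r ≈ 0#) rs → ∀ x → x ^ length rs + ⟦ p ⟧ x ≈ linearProduct rs x
  monic≈linearProduct rs p le rs≉ roots x = trans (+-congˡ (x-y≈0⇒x≈y
    (trans (sym (difference-eval x)) (⟦⟧-zero difference≈0 x)))) (sym (expand-correct rs x))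
    where
    difference = P.add p (map (-_) (expand rs))

    difference-eval : ∀ x → ⟦ difference ⟧ x ≈ ⟦ p ⟧ x - ⟦ expand rs ⟧ x
    difference-eval x = trans (E.eval-add x p _) (+-congˡ (E.eval-neg x (expand rs)))

    length-add-≤ : ∀ {n} p q → length p ℕ.≤ n → length q ℕ.≤ n → length (P.add p q) ℕ.≤ n
    length-add-≤ []      q       _       le      = le
    length-add-≤ (a ∷ p) []      le      _       = le
    length-add-≤ (a ∷ p) (b ∷ q) (s≤s l) (s≤s m) = s≤s (length-add-≤ p q l m)

    difference≈0 : All (_≈ 0#) difference
    difference≈0 = roots⇒≈0 rs difference
      (length-add-≤ p _ le (ℕₚ.≤-reflexive (≡.trans (Listₚ.length-map _ (expand rs)) (length-expand rs)))) rs≉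
      (All.zipWith (λ {r} (root , root′) → trans (difference-eval r)
         (trans (solve 3 (λ u v w → v :- w := (u :+ v) :- (u :+ w)) refl (r ^ length rs) _ _)
           (x≈y⇒x-y≈0 (trans root (trans (sym root′) (expand-correct rs r))))))
       (roots , linearProduct-root rs))

  -- Descent from `K` to ℤ: the hypothesis says that g and the monic polynomial with lower part π
  -- have equal coefficients, so the entries of g are integer preimages of those of π. Where g has
  -- run out, the entry of π vanishes and 0 is its preimage.
  integral : ∀ (π : List Carrier) (g : List ℤ) →
    All (_≈ 0#) (P.add (map (ι K) g) (map (-_) (π ++ 1# ∷ []))) →
    ∃[ γ ] length γ ≡ length π × (∀ x → ⟦ γ ⟧ℤ x ≈ ⟦ π ⟧ x)
  integral []      g       _           = [] , ≡.refl , λ _ → refl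
  integral (b ∷ π) []      (b≈0 ∷ all) with integral π [] all
  ... | γ , len , eq = ℤ.0ℤ ∷ γ , ≡.cong suc len , λ x → +-cong
    (sym (trans (sym (-‿involutive b)) (trans (-‿cong b≈0) -0#≈0#))) (*-congˡ (eq x))
  integral (b ∷ π) (c ∷ g) (c≈b ∷ all) with integral π g all
  ... | γ , len , eq = c ∷ γ , ≡.cong suc len , λ x → +-cong (x-y≈0⇒x≈y c≈b) (*-congˡ (eq x))

  -- g is known through its values and may carry trailing zeros, so its degree is not visible in the
  -- list; long division needs the explicit monic form. With s = 0 the sample points are squares.
  monic : ∀ rs g → (∀ x → ⟦ g ⟧ℤ x ≈ linearProduct rs x) →
    ∃[ γ ] length γ ≡ length rs × (∀ x → ⟦ g ⟧ℤ x ≈ x ^ length rs + ⟦ γ ⟧ℤ x)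
  monic rs g eq with integral (expand rs) g (samples⇒≈0 ℤ.0ℤ _ λ k → begin
      ⟦ P.add (map (ι K) g) (map (-_) (expand rs ++ 1# ∷ [])) ⟧ (x k)
        ≈⟨ trans (E.eval-add (x k) (map (ι K) g) _) (+-congˡ (E.eval-neg (x k) (expand rs ++ 1# ∷ []))) ⟩
      ⟦ map (ι K) g ⟧ (x k) - ⟦ expand rs ++ 1# ∷ [] ⟧ (x k)
        ≈⟨ x≈y⇒x-y≈0 (trans (trans (⟦⟧ℤ-map g (x k)) (eq (x k)))
             (trans (expand-correct rs (x k)) (sym (trans (monic-eval (expand rs) (x k))
               (+-congʳ (reflexive (≡.cong (x k ^_) (length-expand rs)))))))) ⟩
      0# ∎)
    where
    x : ℕ → Carrier
    x k = ι K (sample ℤ.0ℤ k)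
  ... | γ , len , eq′ = γ , ≡.trans len (length-expand rs) ,
    λ x → trans (eq x) (trans (expand-correct rs x) (+-congˡ (sym (eq′ x))))

  splitLast : ∀ d (p : List ℤ) → length p ≡ suc d →
    ∃[ p′ ] ∃[ l ] length p′ ≡ d × (∀ x → ⟦ p ⟧ℤ x ≈ ⟦ p′ ⟧ℤ x + x ^ d * ι K l)
  splitLast zero    (a ∷ [])    len = [] , a , ≡.refl , λ x → begin
    ι K a + x * 0#       ≈⟨ trans (+-congˡ (zeroʳ x)) (+-comm _ _) ⟩
    0# + ι K a           ≈⟨ +-congˡ (*-identityˡ _) ⟨
    0# + 1# * ι K a      ∎
  splitLast (suc d) (a ∷ p)     len with splitLast d p (ℕₚ.suc-injective len)
  ... | p′ , l , len′ , eq = a ∷ p′ , l , ≡.cong suc len′ , λ x → trans (+-congˡ (*-congˡ (eq x)))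
    (solve 5 (λ a x p′ y l → a :+ x :* (p′ :+ y :* l) := (a :+ x :* p′) :+ (x :* y) :* l) refl (ι K a) x _ _ _)

  -- Divide the tail first: if it leaves the remainder r, then a + X r is one entry too long. Its
  -- top coefficient l joins the quotient, and l times the divisor is subtracted; this stays in ℤ
  -- because the divisor is monic.
  divide : ∀ γ p → ∃[ q ] ∃[ r ] length r ≡ length γ ×
    (∀ x → ⟦ p ⟧ℤ x ≈ ⟦ q ⟧ℤ x * (x ^ length γ + ⟦ γ ⟧ℤ x) + ⟦ r ⟧ℤ x)
  divide γ []      = [] , replicate (length γ) ℤ.0ℤ , Listₚ.length-replicate (length γ) ,
    λ x → sym (trans (+-cong (zeroˡ _) (zeros (length γ) x)) (+-identityʳ 0#))
    where
    zeros : ∀ n x → ⟦ replicate n ℤ.0ℤ ⟧ℤ x ≈ 0#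
    zeros zero    x = refl
    zeros (suc n) x = trans (+-identityˡ _) (trans (*-congˡ (zeros n x)) (zeroʳ x))
  divide γ (a ∷ p) with divide γ p
  ... | q , r , len , eq with splitLast (length γ) (a ∷ r) (≡.cong suc len)
  ... | r′ , l , len′ , eq′ = l ∷ q , Pℤ.add r′ (map (ℤ.- l ℤ.*_) γ) ,
    ≡.trans (length-add +-*-rawRing r′ _ (≡.trans len′ (≡.sym (Listₚ.length-map _ γ)))) (Listₚ.length-map _ γ) ,
    λ x → begin
      ι K a + x * ⟦ p ⟧ℤ x              ≈⟨ +-congˡ (*-congˡ (eq x)) ⟩
      ι K a + x * (⟦ q ⟧ℤ x * (x ^ length γ + ⟦ γ ⟧ℤ x) + ⟦ r ⟧ℤ x)
        ≈⟨ solve 5 (λ a x q g r → a :+ x :* (q :* g :+ r) := x :* q :* g :+ (a :+ x :* r)) refl (ι K a) x _ _ _ ⟩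
      x * ⟦ q ⟧ℤ x * (x ^ length γ + ⟦ γ ⟧ℤ x) + ⟦ a ∷ r ⟧ℤ x
        ≈⟨ +-congˡ (eq′ x) ⟩
      x * ⟦ q ⟧ℤ x * (x ^ length γ + ⟦ γ ⟧ℤ x) + (⟦ r′ ⟧ℤ x + x ^ length γ * ι K l)
        ≈⟨ solve 5 (λ xq u γ r l → xq :* (u :+ γ) :+ (r :+ u :* l) :=
             (l :+ xq) :* (u :+ γ) :+ (r :+ (:- l) :* γ)) refl (x * ⟦ q ⟧ℤ x) (x ^ length γ) _ _ (ι K l) ⟩
      (ι K l + x * ⟦ q ⟧ℤ x) * (x ^ length γ + ⟦ γ ⟧ℤ x) + (⟦ r′ ⟧ℤ x + (- ι K l) * ⟦ γ ⟧ℤ x)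
        ≈⟨ +-congˡ (trans (Eℤ.eval-add x r′ _) (+-congˡ (trans (Eℤ.eval-scale x (ℤ.- l) γ) (*-congʳ (ι-neg K l))))) ⟨
      ⟦ l ∷ q ⟧ℤ x * (x ^ length γ + ⟦ γ ⟧ℤ x) + ⟦ Pℤ.add r′ (map (ℤ.- l ℤ.*_) γ) ⟧ℤ x ∎

  -- The remainder has no more coefficients than there are roots and vanishes at each of them, so it
  -- is zero. The quotient keeps integer coefficients although the roots lie only in `K`.
  linearProduct-∣ : ∀ rs g → (∀ x → ⟦ g ⟧ℤ x ≈ linearProduct rs x) → AllPairs (λ r r′ → ¬ r ≈ r′) rs →
    ∀ p → All (λ r → ⟦ p ⟧ℤ r ≈ 0#) rs → ∃[ q ] (∀ x → ⟦ p ⟧ℤ x ≈ ⟦ q ⟧ℤ x * ⟦ g ⟧ℤ x)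
  linearProduct-∣ rs g g≈ rs≉ p roots =
    let γ , len , eq = monic rs g g≈
        q , r , len′ , eq′ = divide γ p
    in q , remainder-vanishes γ len eq q r len′ eq′
    where
    remainder-vanishes : ∀ γ → length γ ≡ length rs → (∀ x → ⟦ g ⟧ℤ x ≈ x ^ length rs + ⟦ γ ⟧ℤ x) →
      ∀ q r → length r ≡ length γ → (∀ x → ⟦ p ⟧ℤ x ≈ ⟦ q ⟧ℤ x * (x ^ length γ + ⟦ γ ⟧ℤ x) + ⟦ r ⟧ℤ x) →
      ∀ x → ⟦ p ⟧ℤ x ≈ ⟦ q ⟧ℤ x * ⟦ g ⟧ℤ x
    remainder-vanishes γ len eq q r len′ eq′ x = begin
      ⟦ p ⟧ℤ x                                          ≈⟨ eq′ x ⟩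
      ⟦ q ⟧ℤ x * (x ^ length γ + ⟦ γ ⟧ℤ x) + ⟦ r ⟧ℤ x   ≈⟨ +-cong (*-congˡ (g≈monic x)) (r≈0 x) ⟩
      ⟦ q ⟧ℤ x * ⟦ g ⟧ℤ x + 0#                          ≈⟨ +-identityʳ _ ⟩
      ⟦ q ⟧ℤ x * ⟦ g ⟧ℤ x                               ∎
      where
      g≈monic : ∀ x → x ^ length γ + ⟦ γ ⟧ℤ x ≈ ⟦ g ⟧ℤ x
      g≈monic x = trans (+-congʳ (reflexive (≡.cong (x ^_) len))) (sym (eq x))

      r-root : ∀ {ρ} → ⟦ p ⟧ℤ ρ ≈ 0# → linearProduct rs ρ ≈ 0# → ⟦ map (ι K) r ⟧ ρ ≈ 0#
      r-root {ρ} p-root g-root = begin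
        ⟦ map (ι K) r ⟧ ρ                                ≈⟨ ⟦⟧ℤ-map r ρ ⟩
        ⟦ r ⟧ℤ ρ                                         ≈⟨ +-identityˡ _ ⟨
        0# + ⟦ r ⟧ℤ ρ
          ≈⟨ +-congʳ (trans (*-congˡ (trans (g≈monic ρ) (trans (g≈ ρ) g-root))) (zeroʳ _)) ⟨
        ⟦ q ⟧ℤ ρ * (ρ ^ length γ + ⟦ γ ⟧ℤ ρ) + ⟦ r ⟧ℤ ρ  ≈⟨ eq′ ρ ⟨
        ⟦ p ⟧ℤ ρ                                         ≈⟨ p-root ⟩
        0#                                               ∎

      r≈0 : ∀ x → ⟦ r ⟧ℤ x ≈ 0#
      r≈0 x = trans (sym (⟦⟧ℤ-map r x)) (⟦⟧-zero (roots⇒≈0 rs (map (ι K) r)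
        (ℕₚ.≤-reflexive (≡.trans (Listₚ.length-map _ r) (≡.trans len′ len))) rs≉
        (All.zipWith (λ (p-root , g-root) → r-root p-root g-root) (roots , linearProduct-root rs))) x)

-- Isobaric polynomials in s and t.

value : List ℤ → ℤ → ℤ
value = evaluate +-*-rawRing id

cancel≢0 : ∀ {c} x → c ≢ ℤ.0ℤ → c ℤ.* x ≡ ℤ.0ℤ → x ≡ ℤ.0ℤ
cancel≢0 {c} x c≢0 cx≡0 with ℤₚ.i*j≡0⇒i≡0∨j≡0 c cx≡0
... | inj₁ c≡0 = contradiction c≡0 c≢0
... | inj₂ x≡0 = x≡0

*-≢0 : ∀ {x y} → x ≢ ℤ.0ℤ → y ≢ ℤ.0ℤ → x ℤ.* y ≢ ℤ.0ℤ
*-≢0 {x} {y} x≢0 y≢0 xy≡0 = y≢0 (cancel≢0 y x≢0 xy≡0)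

-- P = Σ qᵢ(s) tⁱ has the rows qᵢ; weight d means qᵢ(s) = c s ^ (d − 2 i), and qᵢ = 0 for 2 i > d.
-- Excluding s = 0 costs nothing, and lets the powers of s be cancelled.
Isobaric : ℕ → List (List ℤ) → Set
Isobaric d             []      = ⊤
Isobaric zero          (q ∷ p) = (∀ x → x ≢ ℤ.0ℤ → value q x ≡ value q ℤ.1ℤ) ×
                                 All (λ q → ∀ x → x ≢ ℤ.0ℤ → value q x ≡ ℤ.0ℤ) p
Isobaric (suc zero)    (q ∷ p) = (∀ x → x ≢ ℤ.0ℤ → value q x ≡ x ℤ.* value q ℤ.1ℤ) ×
                                 All (λ q → ∀ x → x ≢ ℤ.0ℤ → value q x ≡ ℤ.0ℤ) p
Isobaric (suc (suc d)) (q ∷ p) = (∀ x → x ≢ ℤ.0ℤ → value q x ≡ x ℤ.^ suc (suc d) ℤ.* value q ℤ.1ℤ) ×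
                                 Isobaric d p

-- For fixed x, the coefficients in t of μ P (x , x² t) - c P (1 , t). They vanish for c = μ xᵈ when
-- P is isobaric of weight d. Keeping μ and c apart avoids negative powers of x in the rows with 2 i
-- > d.
homogeneityDefect : ℤ → ℤ → ℤ → List (List ℤ) → List ℤ
homogeneityDefect x c μ []      = []
homogeneityDefect x c μ (q ∷ p) = (μ ℤ.* value q x ℤ.- c ℤ.* value q ℤ.1ℤ) ∷
  homogeneityDefect x c (μ ℤ.* (x ℤ.* x)) p

homogeneityDefect-value : ∀ x c μ p t → value (homogeneityDefect x c μ p) t ≡
  μ ℤ.* p ⟨ x , x ℤ.* x ℤ.* t ⟩ ℤ.- c ℤ.* p ⟨ ℤ.1ℤ , t ⟩
homogeneityDefect-value x c μ []      t =
  solve 2 (λ μ c → con ℤ.0ℤ := μ :* con ℤ.0ℤ :- c :* con ℤ.0ℤ) ≡.refl μ c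
  where open ℤSolver.+-*-Solver
homogeneityDefect-value x c μ (q ∷ p) t = ≡.trans
  (≡.cong (λ r → μ ℤ.* value q x ℤ.- c ℤ.* value q ℤ.1ℤ ℤ.+ t ℤ.* r)
    (homogeneityDefect-value x c (μ ℤ.* (x ℤ.* x)) p t))
  (solve 8 (λ μ u c v t x w z →
     μ :* u :- c :* v :+ t :* (μ :* (x :* x) :* w :- c :* z) :=
     μ :* (u :+ x :* x :* t :* w) :- c :* (v :+ t :* z)) ≡.refl
     μ (value q x) c (value q ℤ.1ℤ) t x (p ⟨ x , x ℤ.* x ℤ.* t ⟩) (p ⟨ ℤ.1ℤ , t ⟩))
  where open ℤSolver.+-*-Solver

-- The hypothesis makes q(1) divisible by every nonzero integer.
homogeneous⇒0 : ∀ e q → (∀ x → x ≢ ℤ.0ℤ → x ℤ.^ suc e ℤ.* value q x ≡ value q ℤ.1ℤ) →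
                ∀ x → x ≢ ℤ.0ℤ → value q x ≡ ℤ.0ℤ
homogeneous⇒0 e q eq x x≢0 = cancel≢0 (value q x) (x≢0 ∘ ℤₚ.i^n≡0⇒i≡0 x (suc e))
  (≡.trans (eq x x≢0) (small⇒0 (value q ℤ.1ℤ) (divides (y ℤ.^ e ℤ.* value q y)
    (≡.trans (≡.sym (eq y λ ())) (rearrange y (y ℤ.^ e) (value q y))))))
  where
  open ℤSolver.+-*-Solver
  -- A modulus exceeding the absolute value of q(1), whose only multiple of that size is 0.
  y = + suc ℤ.∣ value q ℤ.1ℤ ∣

  rearrange : ∀ a b c → a ℤ.* b ℤ.* c ≡ b ℤ.* c ℤ.* a
  rearrange = solve 3 (λ a b c → a :* b :* c := b :* c :* a) ≡.refl

  small⇒0 : ∀ z → + suc ℤ.∣ z ∣ ∣ˢ z → z ≡ ℤ.0ℤ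
  small⇒0 (+ zero)  _ = ≡.refl
  small⇒0 z@(+ suc n) div = contradiction (∣ℕ.∣⇒≤ (∣ℤ.∣⇒∣ᵤ div)) (ℕₚ.<⇒≱ ℕₚ.≤-refl)
  small⇒0 z@(-[1+ n ]) div = contradiction (∣ℕ.∣⇒≤ (∣ℤ.∣⇒∣ᵤ div)) (ℕₚ.<⇒≱ ℕₚ.≤-refl)

-- The rows with 2 i > d. The surplus power of x now sits on the side of μ, so after cancelling c
-- the vanishing defect reads x ^ (e + 1) · q(x) = q(1), which `homogeneous⇒0` excludes unless q
-- vanishes.
defect≡0⇒zeroRows : ∀ (c μ : ℤ → ℤ) e p → (∀ x → x ≢ ℤ.0ℤ → c x ≢ ℤ.0ℤ) → (∀ x → μ x ≡ c x ℤ.* x ℤ.^ suc e) →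
  (∀ x → x ≢ ℤ.0ℤ → All (_≡ ℤ.0ℤ) (homogeneityDefect x (c x) (μ x) p)) →
  All (λ q → ∀ x → x ≢ ℤ.0ℤ → value q x ≡ ℤ.0ℤ) p
defect≡0⇒zeroRows c μ e []      c≢0 μ≡ defect≡0 = []
defect≡0⇒zeroRows c μ e (q ∷ p) c≢0 μ≡ defect≡0 =
  homogeneous⇒0 e q (λ x x≢0 → ℤₚ.i-j≡0⇒i≡j _ _ (cancel≢0 _ (c≢0 x x≢0) (row x x≢0))) ∷
  defect≡0⇒zeroRows c (λ x → μ x ℤ.* (x ℤ.* x)) (suc (suc e)) p c≢0
    (λ x → ≡.trans (≡.cong (ℤ._* (x ℤ.* x)) (μ≡ x)) (rearrange (c x) x (x ℤ.^ e)))
    (λ x x≢0 → All.tail (defect≡0 x x≢0))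
  where
  open ℤSolver.+-*-Solver
  rearrange : ∀ c x y → c ℤ.* (x ℤ.* y) ℤ.* (x ℤ.* x) ≡ c ℤ.* (x ℤ.* (x ℤ.* (x ℤ.* y)))
  rearrange = solve 3 (λ c x y → c :* (x :* y) :* (x :* x) := c :* (x :* (x :* (x :* y)))) ≡.refl

  row : ∀ x → x ≢ ℤ.0ℤ → c x ℤ.* (x ℤ.^ suc e ℤ.* value q x ℤ.- value q ℤ.1ℤ) ≡ ℤ.0ℤ
  row x x≢0 = ≡.trans
    (solve 4 (λ c y u v → c :* (y :* u :- v) := c :* y :* u :- c :* v)
      ≡.refl (c x) (x ℤ.^ suc e) (value q x) (value q ℤ.1ℤ))
    (≡.trans (≡.cong (λ z → z ℤ.* value q x ℤ.- c x ℤ.* value q ℤ.1ℤ) (≡.sym (μ≡ x))) (All.head (defect≡0 x x≢0)))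

-- Each row moves a factor x² from xᵈ into μ. When d has come down to 0 or 1, the next move leaves a
-- surplus of x² or x, whence the values e = 1 and e = 0 passed to `defect≡0⇒zeroRows`.
defect≡0⇒isobaric : ∀ (c μ : ℤ → ℤ) d p → (∀ x → x ≢ ℤ.0ℤ → μ x ≢ ℤ.0ℤ) → (∀ x → c x ≡ μ x ℤ.* x ℤ.^ d) →
  (∀ x → x ≢ ℤ.0ℤ → All (_≡ ℤ.0ℤ) (homogeneityDefect x (c x) (μ x) p)) → Isobaric d p
defect≡0⇒isobaric c μ d []      μ≢0 c≡ defect≡0 = tt
defect≡0⇒isobaric c μ d (q ∷ p) μ≢0 c≡ defect≡0 = result d c≡
  where
  open ℤSolver.+-*-Solver
  row : ∀ d → (∀ x → c x ≡ μ x ℤ.* x ℤ.^ d) → ∀ x → x ≢ ℤ.0ℤ → value q x ≡ x ℤ.^ d ℤ.* value q ℤ.1ℤ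
  row d c≡ x x≢0 = ℤₚ.i-j≡0⇒i≡j _ _ (cancel≢0 _ (μ≢0 x x≢0) (≡.trans
    (solve 4 (λ c y u v → c :* (u :- y :* v) := c :* u :- c :* y :* v)
      ≡.refl (μ x) (x ℤ.^ d) (value q x) (value q ℤ.1ℤ))
    (≡.trans (≡.cong (λ z → μ x ℤ.* value q x ℤ.- z ℤ.* value q ℤ.1ℤ) (≡.sym (c≡ x))) (All.head (defect≡0 x x≢0)))))

  tail : ∀ x → x ≢ ℤ.0ℤ → All (_≡ ℤ.0ℤ) (homogeneityDefect x (c x) (μ x ℤ.* (x ℤ.* x)) p)
  tail x x≢0 = All.tail (defect≡0 x x≢0)

  result : ∀ d → (∀ x → c x ≡ μ x ℤ.* x ℤ.^ d) → Isobaric d (q ∷ p)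
  result zero c≡ = (λ x x≢0 → ≡.trans (row 0 c≡ x x≢0) (ℤₚ.*-identityˡ _)) ,
    defect≡0⇒zeroRows c (λ x → μ x ℤ.* (x ℤ.* x)) 1 p
      (λ x x≢0 cx≡0 → *-≢0 (μ≢0 x x≢0) (λ ()) (≡.trans (≡.sym (c≡ x)) cx≡0))
      (λ x → ≡.trans (solve 2 (λ μ x → μ :* (x :* x) := μ :* con ℤ.1ℤ :* (x :* (x :* con ℤ.1ℤ))) ≡.refl (μ x) x)
                     (≡.cong (ℤ._* x ℤ.^ 2) (≡.sym (c≡ x)))) tail
  result (suc zero) c≡ = (λ x x≢0 → ≡.trans (row 1 c≡ x x≢0) (≡.cong (ℤ._* value q ℤ.1ℤ) (ℤₚ.*-identityʳ x))) ,
    defect≡0⇒zeroRows c (λ x → μ x ℤ.* (x ℤ.* x)) 0 p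
      (λ x x≢0 cx≡0 → *-≢0 (μ≢0 x x≢0)
        (λ x1≡0 → x≢0 (≡.trans (≡.sym (ℤₚ.*-identityʳ x)) x1≡0)) (≡.trans (≡.sym (c≡ x)) cx≡0))
      (λ x → ≡.trans (solve 2 (λ μ x → μ :* (x :* x) := μ :* (x :* con ℤ.1ℤ) :* (x :* con ℤ.1ℤ)) ≡.refl (μ x) x)
                     (≡.cong (ℤ._* x ℤ.^ 1) (≡.sym (c≡ x)))) tail
  result (suc (suc d)) c≡ = row (suc (suc d)) c≡ ,
    defect≡0⇒isobaric c (λ x → μ x ℤ.* (x ℤ.* x)) d p
      (λ x x≢0 → *-≢0 (μ≢0 x x≢0) (*-≢0 x≢0 x≢0))
      (λ x → ≡.trans (c≡ x) (solve 3 (λ μ x y → μ :* (x :* (x :* y)) := μ :* (x :* x) :* y) ≡.refl (μ x) x (x ℤ.^ d))) tail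

-- In weight 2 m the row m has degree 0 in s, so this is the coefficient of the term tᵐ, the one
-- with the lowest power of s.
lowestCoefficient : ℕ → List (List ℤ) → ℤ
lowestCoefficient m       []      = ℤ.0ℤ
lowestCoefficient zero    (q ∷ p) = value q ℤ.1ℤ
lowestCoefficient (suc m) (q ∷ p) = lowestCoefficient m p

zeroRows⇒0 : ∀ p {x} t → x ≢ ℤ.0ℤ → All (λ q → ∀ x → x ≢ ℤ.0ℤ → value q x ≡ ℤ.0ℤ) p → p ⟨ x , t ⟩ ≡ ℤ.0ℤ
zeroRows⇒0 []      t x≢0 []         = ≡.refl
zeroRows⇒0 (q ∷ p) t x≢0 (q≡0 ∷ p≡0) = ≡.trans
  (≡.cong₂ (λ u v → u ℤ.+ t ℤ.* v) (q≡0 _ x≢0) (zeroRows⇒0 p t x≢0 p≡0))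
  (≡.trans (ℤₚ.+-identityˡ _) (ℤₚ.*-zeroʳ t))

-- The term s ^ (2 m - 2 i) tⁱ equals βᵐ (3 S) ^ (m - i) Tⁱ, so only i = m escapes a factor 3. The
-- scale β is a parameter because both β = 3ᵇ and β = 1 are needed.
even-isobaric : ∀ m p {s t β S T} → Isobaric (m ℕ.* 2) p → s ≢ ℤ.0ℤ →
  s ℤ.* s ≡ β ℤ.* (+ 3 ℤ.* S) → t ≡ β ℤ.* T →
  ∃[ w ] p ⟨ s , t ⟩ ≡ β ℤ.^ m ℤ.* (lowestCoefficient m p ℤ.* T ℤ.^ m ℤ.+ + 3 ℤ.* w)
even-isobaric m [] {β = β} {T = T} _ s≢0 s²≡ t≡ = ℤ.0ℤ ,
  solve 2 (λ b u → con ℤ.0ℤ := b :* (con ℤ.0ℤ :* u :+ con (+ 3) :* con ℤ.0ℤ)) ≡.refl (β ℤ.^ m) (T ℤ.^ m)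
  where open ℤSolver.+-*-Solver
even-isobaric zero (q ∷ p) {s} {t} (q≡ , p≡0) s≢0 s²≡ t≡ = ℤ.0ℤ , (begin
  value q s ℤ.+ t ℤ.* p ⟨ s , t ⟩
    ≡⟨ ≡.cong₂ (λ u v → u ℤ.+ t ℤ.* v) (q≡ s s≢0) (zeroRows⇒0 p t s≢0 p≡0) ⟩
  value q ℤ.1ℤ ℤ.+ t ℤ.* ℤ.0ℤ
    ≡⟨ solve 2 (λ u t → u :+ t :* con ℤ.0ℤ := con ℤ.1ℤ :* (u :* con ℤ.1ℤ :+ con (+ 3) :* con ℤ.0ℤ)) ≡.refl (value q ℤ.1ℤ) t ⟩
  _ ∎)
  where
  open ℤSolver.+-*-Solver
  open ≡-Reasoning
even-isobaric (suc m) (q ∷ p) {s} {t} {β} {S} {T} (q≡ , iso) s≢0 s²≡ t≡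
  with even-isobaric m p iso s≢0 s²≡ t≡
... | w , eq = S ℤ.* (+ 3 ℤ.* S) ℤ.^ m ℤ.* value q ℤ.1ℤ ℤ.+ T ℤ.* w , (begin
  value q s ℤ.+ t ℤ.* p ⟨ s , t ⟩
    ≡⟨ ≡.cong₂ (λ u v → u ℤ.+ t ℤ.* v) (q≡ s s≢0) eq ⟩
  s ℤ.^ (2 ℕ.+ m ℕ.* 2) ℤ.* value q ℤ.1ℤ ℤ.+ t ℤ.* (β ℤ.^ m ℤ.* R)
    ≡⟨ ≡.cong₂ (λ u v → u ℤ.* value q ℤ.1ℤ ℤ.+ v ℤ.* (β ℤ.^ m ℤ.* R)) (power (suc m)) t≡ ⟩
  β ℤ.^ suc m ℤ.* (+ 3 ℤ.* S) ℤ.^ suc m ℤ.* value q ℤ.1ℤ ℤ.+ β ℤ.* T ℤ.* (β ℤ.^ m ℤ.* R)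
    ≡⟨ solve 9 (λ β b S z v T l u w →
         β :* b :* (con (+ 3) :* S :* z) :* v :+ β :* T :* (b :* (l :* u :+ con (+ 3) :* w)) :=
         β :* b :* (l :* (T :* u) :+ con (+ 3) :* (S :* z :* v :+ T :* w))) ≡.refl
         β (β ℤ.^ m) S ((+ 3 ℤ.* S) ℤ.^ m) (value q ℤ.1ℤ) T (lowestCoefficient m p) (T ℤ.^ m) w ⟩
  _ ∎)
  where
  open ℤSolver.+-*-Solver
  open ≡-Reasoning
  R = lowestCoefficient m p ℤ.* T ℤ.^ m ℤ.+ + 3 ℤ.* w

  power : ∀ m → s ℤ.^ (m ℕ.* 2) ≡ β ℤ.^ m ℤ.* (+ 3 ℤ.* S) ℤ.^ m
  power zero    = ≡.refl
  power (suc m) = begin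
    s ℤ.* (s ℤ.* s ℤ.^ (m ℕ.* 2))                            ≡⟨ ℤₚ.*-assoc s s _ ⟨
    s ℤ.* s ℤ.* s ℤ.^ (m ℕ.* 2)                              ≡⟨ ≡.cong₂ ℤ._*_ s²≡ (power m) ⟩
    β ℤ.* (+ 3 ℤ.* S) ℤ.* (β ℤ.^ m ℤ.* (+ 3 ℤ.* S) ℤ.^ m)
      ≡⟨ solve 4 (λ a b c d → a :* b :* (c :* d) := a :* c :* (b :* d)) ≡.refl β (+ 3 ℤ.* S) _ _ ⟩
    β ℤ.^ suc m ℤ.* (+ 3 ℤ.* S) ℤ.^ suc m                    ∎

-- In odd weight every term contains s. At s = 3 this is what rules out an odd φ n.
odd-isobaric : ∀ m p {i s} t → Isobaric (suc (m ℕ.* 2)) p → s ≢ ℤ.0ℤ → i ∣ˢ s → i ∣ˢ p ⟨ s , t ⟩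
odd-isobaric m [] t _ s≢0 i∣s = divides ℤ.0ℤ ≡.refl
odd-isobaric zero (q ∷ p) t (q≡ , p≡0) s≢0 i∣s = ∣ℤ.∣m∣n⇒∣m+n
  (≡.subst (_ ∣ˢ_) (≡.sym (q≡ _ s≢0)) (∣ℤ.∣m⇒∣m*n (value q ℤ.1ℤ) i∣s))
  (∣ℤ.∣n⇒∣m*n t (≡.subst (_ ∣ˢ_) (≡.sym (zeroRows⇒0 p t s≢0 p≡0)) (divides ℤ.0ℤ ≡.refl)))
odd-isobaric (suc m) (q ∷ p) t (q≡ , iso) s≢0 i∣s = ∣ℤ.∣m∣n⇒∣m+n
  (≡.subst (_ ∣ˢ_) (≡.sym (q≡ _ s≢0)) (∣ℤ.∣m⇒∣m*n (value q ℤ.1ℤ) (∣ℤ.∣m⇒∣m*n _ i∣s)))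
  (∣ℤ.∣n⇒∣m*n t (odd-isobaric m p t iso s≢0 i∣s))

-- Powers of a primitive root of unity and the polynomials they annihilate.

coprimesUpTo-bounds : ∀ n → All (λ j → 1 ℕ.≤ j × j ℕ.≤ n) (coprimesUpTo n)
coprimesUpTo-bounds n = Allₚ.filter⁺ _ (Allₚ.map⁺ (All.map (λ i<n → s≤s z≤n , i<n) (Allₚ.all-upTo n)))

coprimesUpTo-coprime : ∀ n → All (λ j → gcd j n ≡ 1) (coprimesUpTo n)
coprimesUpTo-coprime n = Allₚ.all-filter (λ j → gcd j n ℕₚ.≟ 1) (map suc (upTo n))

coprimesUpTo-increasing : ∀ n → AllPairs ℕ._<_ (coprimesUpTo n)
coprimesUpTo-increasing n = AllPairsₚ.filter⁺ _ (AllPairsₚ.map⁺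
  (AllPairsₚ.applyUpTo⁺₁ id n λ i<j _ → s≤s i<j))

-- 1 + Xᵏ + ... + X ^ (k (p - 1)), which for k ≥ 1 is the quotient of X ^ (k p) - 1 by Xᵏ - 1.
geometric : ℕ → ℕ → List ℤ
geometric k zero    = []
geometric k (suc p) = Polynomial.add +-*-rawRing (ℤ.1ℤ ∷ []) (replicate k ℤ.0ℤ ++ geometric k p)

module _ {c ℓ₁ ℓ₂ : Level} (K : HeytingField c ℓ₁ ℓ₂) (char0 : CharacteristicZero K) where
  open CommutativeRing (commutativeRing K) hiding (zero)
  open RingProperties ring
  open Exp commutativeSemiring using (_^_; ^-homo-*; ^-assocʳ; ^-congˡ)
  open Solver K using (solve; _:=_; _:+_; _:*_; _:-_; :-_; con)
  open SetoidReasoning setoid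
  open Roots K char0
  private
    module Eℤ = Evaluation +-*-rawRing (commutativeRing K) (ι K) (ι-isHomomorphism K)

  1≉0 : ¬ 1# ≈ 0#
  1≉0 1≈0 = char0 1 (s≤s z≤n) (trans (+-identityʳ 1#) 1≈0)

  geometric-correct : ∀ k p x → (x ^ k - 1#) * ⟦ geometric k p ⟧ℤ x ≈ (x ^ k) ^ p - 1#
  geometric-correct k zero    x = trans (zeroʳ _) (sym (-‿inverseʳ 1#))
  geometric-correct k (suc p) x = begin
    (x ^ k - 1#) * ⟦ geometric k (suc p) ⟧ℤ x
      ≈⟨ *-congˡ (trans (Eℤ.eval-add x (ℤ.1ℤ ∷ []) (replicate k ℤ.0ℤ ++ geometric k p))
           (+-cong (trans (Eℤ.eval-const x ℤ.1ℤ) (+-identityʳ 1#)) (Eℤ.eval-shift x k (geometric k p)))) ⟩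
    (x ^ k - 1#) * (1# + x ^ k * ⟦ geometric k p ⟧ℤ x)
      ≈⟨ solve 3 (λ z u g → (z :- u) :* (u :+ z :* g) := z :* u :- u :* u :+ z :* ((z :- u) :* g)) refl (x ^ k) 1# _ ⟩
    x ^ k * 1# - 1# * 1# + x ^ k * ((x ^ k - 1#) * ⟦ geometric k p ⟧ℤ x)
      ≈⟨ +-congˡ (*-congˡ (geometric-correct k p x)) ⟩
    x ^ k * 1# - 1# * 1# + x ^ k * ((x ^ k) ^ p - 1#)
      ≈⟨ solve 3 (λ z u w → z :* u :- u :* u :+ z :* (w :- u) := z :* w :- u :* u) refl (x ^ k) 1# ((x ^ k) ^ p) ⟩
    (x ^ k) ^ suc p - 1# * 1#
      ≈⟨ +-congˡ (-‿cong (*-identityʳ 1#)) ⟩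
    (x ^ k) ^ suc p - 1#  ∎

  module PrimitiveRoot {n : ℕ} (1≤n : 1 ℕ.≤ n) (ω : Carrier) (prim : IsPrimitiveRoot K n ω) where
    ω^n≈1 : ω ^ n ≈ 1#
    ω^n≈1 = proj₁ prim

    1^ : ∀ k → 1# ^ k ≈ 1#
    1^ zero    = refl
    1^ (suc k) = trans (*-identityˡ _) (1^ k)

    ω^k≉0 : ∀ k → k ℕ.≤ n → ¬ ω ^ k ≈ 0#
    ω^k≉0 k k≤n ω^k≈0 = 1≉0 (begin
      1#                      ≈⟨ ω^n≈1 ⟨
      ω ^ n                   ≡⟨ ≡.cong (ω ^_) (≡.sym (ℕₚ.m+[n∸m]≡n k≤n)) ⟩
      ω ^ (k ℕ.+ (n ℕ.∸ k))   ≈⟨ ^-homo-* ω k (n ℕ.∸ k) ⟩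
      ω ^ k * ω ^ (n ℕ.∸ k)   ≈⟨ x*x′≈0 _ ω^k≈0 ⟩
      0#                      ∎)

    ω^n*q≈1 : ∀ q → ω ^ (q ℕ.* n) ≈ 1#
    ω^n*q≈1 q = begin
      ω ^ (q ℕ.* n)  ≡⟨ ≡.cong (ω ^_) (ℕₚ.*-comm q n) ⟩
      ω ^ (n ℕ.* q)  ≈⟨ ^-assocʳ ω n q ⟨
      (ω ^ n) ^ q    ≈⟨ ^-congˡ q ω^n≈1 ⟩
      1# ^ q         ≈⟨ 1^ q ⟩
      1#             ∎

    ω^k≈1⇒n∣k : ∀ k → ω ^ k ≈ 1# → n ∣ℕ.∣ k
    ω^k≈1⇒n∣k k ω^k≈1 = byRemainder (k ℕ.% n) ≡.refl
      where
      instance n≢0 = ℕ.>-nonZero 1≤n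
      ω^r≈1 : ω ^ (k ℕ.% n) ≈ 1#
      ω^r≈1 = begin
        ω ^ (k ℕ.% n)                            ≈⟨ *-identityʳ _ ⟨
        ω ^ (k ℕ.% n) * 1#                       ≈⟨ *-congˡ (ω^n*q≈1 (k ℕ./ n)) ⟨
        ω ^ (k ℕ.% n) * ω ^ ((k ℕ./ n) ℕ.* n)    ≈⟨ ^-homo-* ω (k ℕ.% n) _ ⟨
        ω ^ (k ℕ.% n ℕ.+ (k ℕ./ n) ℕ.* n)        ≡⟨ ≡.cong (ω ^_) (≡.sym (m≡m%n+[m/n]*n k n)) ⟩
        ω ^ k                                    ≈⟨ ω^k≈1 ⟩
        1#                                       ∎
      byRemainder : ∀ r → k ℕ.% n ≡ r → n ∣ℕ.∣ k
      byRemainder zero    eq = ∣ℕ.m%n≡0⇒n∣m k n eq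
      byRemainder (suc r) eq = contradiction (≡.subst (λ r → ω ^ r ≈ 1#) eq ω^r≈1)
        (proj₂ prim (suc r) (s≤s z≤n) (≡.subst (ℕ._< n) eq (m%n<n k n)))

    powers-distinct : AllPairs (λ i j → ¬ ω ^ i ≈ ω ^ j) (coprimesUpTo n)
    powers-distinct = AllPairs.zipWith (λ (i<j , b) → distinct i<j b)
      (coprimesUpTo-increasing n , bounds (coprimesUpTo-bounds n))
      where
      bounds : ∀ {P : ℕ → Set} {xs} → All P xs → AllPairs (λ i j → P i × P j) xs
      bounds []         = []
      bounds (px ∷ pxs) = All.map (px ,_) pxs ∷ bounds pxs

      distinct : ∀ {i j} → i ℕ.< j → (1 ℕ.≤ i × i ℕ.≤ n) × (1 ℕ.≤ j × j ℕ.≤ n) → ¬ ω ^ i ≈ ω ^ j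
      distinct {i} {j} i<j ((1≤i , i≤n) , (_ , j≤n)) ω^i≈ω^j =
        proj₂ prim (j ℕ.∸ i) (ℕₚ.m<n⇒0<n∸m i<j)
          (ℕₚ.<-≤-trans (ℕₚ.∸-monoʳ-< 1≤i (ℕₚ.<⇒≤ i<j)) j≤n)
          (x-y≈0⇒x≈y (x*y≈0⇒y≈0 K (ω^k≉0 i i≤n) (begin
            ω ^ i * (ω ^ (j ℕ.∸ i) - 1#)
              ≈⟨ solve 3 (λ x y z → x :* (y :- z) := x :* y :- x :* z) refl _ _ 1# ⟩
            ω ^ i * ω ^ (j ℕ.∸ i) - ω ^ i * 1#
              ≈⟨ +-cong (trans (sym (^-homo-* ω i (j ℕ.∸ i))) (reflexive (≡.cong (ω ^_) (ℕₚ.m+[n∸m]≡n (ℕₚ.<⇒≤ i<j)))))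
                   (-‿cong (*-identityʳ _)) ⟩
            ω ^ j - ω ^ i ≈⟨ x≈y⇒x-y≈0 (sym ω^i≈ω^j) ⟩
            0# ∎)))

    roots : List Carrier
    roots = map (ω ^_) (coprimesUpTo n)

    roots-distinct : AllPairs (λ r r′ → ¬ r ≈ r′) roots
    roots-distinct = AllPairsₚ.map⁺ powers-distinct

    [ω^j]^k≈1⇒n∣k : ∀ {j} k → gcd j n ≡ 1 → (ω ^ j) ^ k ≈ 1# → n ∣ℕ.∣ k
    [ω^j]^k≈1⇒n∣k {j} k gcd≡1 eq = Coprimality.coprime-divisor
      (Coprimality.sym (Coprimality.gcd≡1⇒coprime {j} {n} gcd≡1)) (ω^k≈1⇒n∣k (j ℕ.* k) (trans (sym (^-assocʳ ω j k)) eq))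

    [ω^j]^n≈1 : ∀ j → (ω ^ j) ^ n ≈ 1#
    [ω^j]^n≈1 j = trans (^-assocʳ ω j n) (ω^n*q≈1 j)

    -- For r = ωʲ one has rⁿ = 1, while rᵏ = 1 would make n divide the smaller number k; so the
    -- factor rᵏ - 1 can be cancelled.
    geometric-roots : ∀ {k p} → n ≡ k ℕ.* p → 1 ℕ.≤ k → 1 ℕ.< p → All (λ r → ⟦ geometric k p ⟧ℤ r ≈ 0#) roots
    geometric-roots {k} {p} n≡kp 1≤k 1<p = Allₚ.map⁺ (All.map (λ {j} → root j) (coprimesUpTo-coprime n))
      where
      instance k≢0 = ℕ.>-nonZero 1≤k
      root : ∀ j → gcd j n ≡ 1 → ⟦ geometric k p ⟧ℤ (ω ^ j) ≈ 0#
      root j gcd≡1 = x*y≈0⇒y≈0 K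
        (λ x^k-1≈0 → ℕₚ.<⇒≱ (≡.subst (k ℕ.<_) (≡.sym n≡kp) (ℕₚ.m<m*n k p 1<p))
          (∣ℕ.∣⇒≤ ([ω^j]^k≈1⇒n∣k {j} k gcd≡1 (x-y≈0⇒x≈y x^k-1≈0))))
        (trans (geometric-correct k p (ω ^ j)) (x≈y⇒x-y≈0
          (trans (^-assocʳ (ω ^ j) k p) (trans (reflexive (≡.cong ((ω ^ j) ^_) (≡.sym n≡kp))) ([ω^j]^n≈1 j)))))

  module _ (n : ℕ) (ω : Carrier) (P : List (List ℤ))
           (atom : RawRing._≈_ (K[α,β] K) (substituted K P) (Φ K n ω)) where
    private
      module B = RawRing (K[α,β] K)
      module Bi = Bivariate rawRing

    -- Both sides of `atom` are built from X, Y and constants by ring operations, so a homomorphism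
    -- is followed through them knowing only its effect on these three.
    homomorphism-product : (h : B.Carrier → Carrier) → IsHomomorphism (K[α,β] K) (commutativeRing K) h →
      ∀ x y → h Bi.X ≈ x → h Bi.Y ≈ y → (∀ k → h (Bi.const k) ≈ k) →
      evaluate₂ rawRing (ι K) P (x + y) (- (x * y)) ≈
      foldr _*_ 1# (map (λ j → x - ω ^ j * y) (coprimesUpTo n))
    homomorphism-product h h-hom x y X≈ Y≈ const≈ = begin
      evaluate₂ rawRing (ι K) P (x + y) (- (x * y))
        ≈⟨ evaluate₂-natural (K[α,β] K) (commutativeRing K) h h-hom _ (ι K)
             (λ i → const≈ (ι K i)) P
             (trans (+-homo Bi.X Bi.Y) (+-cong X≈ Y≈))
             (trans (-‿homo (Bi.X B.* Bi.Y)) (-‿cong (trans (*-homo Bi.X Bi.Y) (*-cong X≈ Y≈)))) ⟨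
      h (substituted K P)  ≈⟨ ⟦⟧-cong atom ⟩
      h (Φ K n ω)
        ≈⟨ product-natural (K[α,β] K) (commutativeRing K) h h-hom _ _ (λ j →
             trans (+-homo Bi.X (B.- (Bi.const (ω ^ j) B.* Bi.Y)))
               (+-cong X≈ (trans (-‿homo (Bi.const (ω ^ j) B.* Bi.Y))
               (-‿cong (trans (*-homo (Bi.const (ω ^ j)) Bi.Y) (*-cong (const≈ (ω ^ j)) Y≈))))))
             (coprimesUpTo n) ⟩
      foldr _*_ 1# (map (λ j → x - ω ^ j * y) (coprimesUpTo n)) ∎
      where open RingMorphisms.IsRingHomomorphism h-hom

    value-product : ∀ x y → evaluate₂ rawRing (ι K) P (x + y) (- (x * y)) ≈
      foldr _*_ 1# (map (λ j → x - ω ^ j * y) (coprimesUpTo n))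
    value-product x y = homomorphism-product O.eval O.eval-isHomomorphism x y
      (trans (O.eval-const (Polynomial.X rawRing)) I.eval-X) O.eval-X
      (λ k → trans (O.eval-const (Polynomial.const rawRing k)) (I.eval-const k))
      where
      -- The inner evaluation puts x for α in the coefficients, the outer one puts y for β.
      module I = Evaluation rawRing (commutativeRing K) id (id-isHomomorphism (commutativeRing K)) x
      module O = Evaluation (Polynomial.rawRing rawRing) (commutativeRing K) I.eval I.eval-isHomomorphism y

-- The iteration (s , t) ↦ (s³ + 3 s t , t³).

module CubeMap {r ℓr : Level} (R : RawRing r ℓr) where
  open RawRing R

  -- (σ k , τ k) is (α ^ 3ᵏ + β ^ 3ᵏ , − (α β) ^ 3ᵏ) when s = α + β and t = − α β.
  τ : ℕ → Carrier → Carrier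
  τ zero    t = t
  τ (suc k) t = τ k t * (τ k t * τ k t)

  σ : ℕ → Carrier → Carrier → Carrier
  -- With A = α ^ 3ᵏ and B = β ^ 3ᵏ this is (A + B)² - 3 A B = A² - A B + B², which is both Φ₆(A ,
  -- B) and the cofactor of A + B in A³ + B³.
  sixth : ℕ → Carrier → Carrier → Carrier

  σ zero    s t = s
  σ (suc k) s t = σ k s t * sixth k s t

  sixth k s t = σ k s t * σ k s t + (τ k t + (τ k t + τ k t))

module _ {r ℓr c ℓ : Level} (R : RawRing r ℓr) (S : CommutativeRing c ℓ)
         (h : RawRing.Carrier R → CommutativeRing.Carrier S) (h-hom : IsHomomorphism R S h) where
  open CommutativeRing S hiding (zero)
  open RingMorphisms.IsRingHomomorphism h-hom
  private
    module R = CubeMap R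
    module S = CubeMap rawRing

  τ-natural : ∀ k {t t′} → h t ≈ t′ → h (R.τ k t) ≈ S.τ k t′
  τ-natural zero    t≈ = t≈
  τ-natural (suc k) t≈ = trans (*-homo _ _) (*-cong (τ-natural k t≈)
    (trans (*-homo _ _) (*-cong (τ-natural k t≈) (τ-natural k t≈))))

  σ-natural : ∀ k {s t s′ t′} → h s ≈ s′ → h t ≈ t′ → h (R.σ k s t) ≈ S.σ k s′ t′
  sixth-natural : ∀ k {s t s′ t′} → h s ≈ s′ → h t ≈ t′ → h (R.sixth k s t) ≈ S.sixth k s′ t′

  σ-natural zero    s≈ t≈ = s≈
  σ-natural (suc k) s≈ t≈ = trans (*-homo _ _) (*-cong (σ-natural k s≈ t≈) (sixth-natural k s≈ t≈))

  sixth-natural k s≈ t≈ = trans (+-homo _ _) (+-cong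
    (trans (*-homo _ _) (*-cong (σ-natural k s≈ t≈) (σ-natural k s≈ t≈)))
    (trans (+-homo _ _) (+-cong (τ-natural k t≈) (trans (+-homo _ _) (+-cong (τ-natural k t≈) (τ-natural k t≈))))))

value-isHomomorphism : ∀ t → IsHomomorphism (Polynomial.rawRing +-*-rawRing) ℤ-ring (λ p → value p t)
value-isHomomorphism t = Evaluation.eval-isHomomorphism +-*-rawRing ℤ-ring id (id-isHomomorphism ℤ-ring) t

-- Consequences of the product formula for the integer values of one Lucas atom.

module _ {c ℓ₁ ℓ₂ : Level} (K : HeytingField c ℓ₁ ℓ₂) (char0 : CharacteristicZero K) where
  open CommutativeRing (commutativeRing K) hiding (zero)
  open RingProperties ring
  open Exp commutativeSemiring using (_^_; ^-homo-*; ^-assocʳ; ^-distrib-*)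
  open Solver K using (solve; _:=_; _:+_; _:*_; _:-_; :-_; con)
  open SetoidReasoning setoid
  open Roots K char0
  private
    module Pℤ = Polynomial +-*-rawRing
    module Eℤ = Evaluation +-*-rawRing (commutativeRing K) (ι K) (ι-isHomomorphism K)
    module C = CubeMap rawRing
    module Cℤ = CubeMap +-*-rawRing

  -- The bridge from the t for which X² - s X - t splits over ℤ to all t: for fixed s the difference
  -- is a polynomial in t with infinitely many zeros.
  agreement⇒≡ : ∀ P B s → (∀ k → P ⟨ s , sample s k ⟩ ≡ value B (sample s k)) → ∀ t → P ⟨ s , t ⟩ ≡ value B t
  agreement⇒≡ P B s agree t = ℤₚ.i-j≡0⇒i≡j _ _ (≡.trans (≡.sym (difference-value t))
    (zero-value (samples⇒≡0 s difference λ k → ≡.trans (difference-value (sample s k)) (ℤₚ.i≡j⇒i-j≡0 (agree k))) t))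
    where
    section : List (List ℤ) → List ℤ
    section = map λ q → value q s

    section-value : ∀ P t → value (section P) t ≡ P ⟨ s , t ⟩
    section-value []      t = ≡.refl
    section-value (q ∷ P) t = ≡.cong (λ r → value q s ℤ.+ t ℤ.* r) (section-value P t)

    difference = Pℤ.add (section P) (map (ℤ.-_) B)

    difference-value : ∀ t → value difference t ≡ P ⟨ s , t ⟩ ℤ.- value B t
    difference-value t = ≡.trans (H.+-homo (section P) (map (ℤ.-_) B)) (≡.cong₂ ℤ._+_ (section-value P t) (H.-‿homo B))
      where module H = RingMorphisms.IsRingHomomorphism (value-isHomomorphism t)

    zero-value : ∀ {p} → All (_≡ ℤ.0ℤ) p → ∀ t → value p t ≡ ℤ.0ℤ
    zero-value []            t = ≡.refl
    zero-value (≡.refl ∷ p≡0) t = ≡.trans (ℤₚ.+-identityˡ _) (≡.trans (≡.cong (t ℤ.*_) (zero-value p≡0 t)) (ℤₚ.*-zeroʳ t))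

  ι-^ : ∀ i k → ι K (i ℤ.^ k) ≈ ι K i ^ k
  ι-^ i zero    = +-identityʳ 1#
  ι-^ i (suc k) = trans (ι-* K i (i ℤ.^ k)) (*-congˡ (ι-^ i k))

  τ-power : ∀ k x y → C.τ k (- (x * y)) ≈ - (x ^ (3 ℕ.^ k) * y ^ (3 ℕ.^ k))
  σ-power : ∀ k x y → C.σ k (x + y) (- (x * y)) ≈ x ^ (3 ℕ.^ k) + y ^ (3 ℕ.^ k)
  sixth-power : ∀ k x y → C.sixth k (x + y) (- (x * y)) ≈
    x ^ (3 ℕ.^ k) * x ^ (3 ℕ.^ k) - x ^ (3 ℕ.^ k) * y ^ (3 ℕ.^ k) + y ^ (3 ℕ.^ k) * y ^ (3 ℕ.^ k)

  cube : ∀ x m → x ^ (3 ℕ.* m) ≈ x ^ m * (x ^ m * x ^ m)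
  cube x m = trans (^-homo-* x m (m ℕ.+ (m ℕ.+ 0))) (*-congˡ (trans (^-homo-* x m (m ℕ.+ 0))
    (*-congˡ (reflexive (≡.cong (x ^_) (ℕₚ.+-identityʳ m))))))

  τ-power zero    x y = -‿cong (*-cong (sym (*-identityʳ x)) (sym (*-identityʳ y)))
  τ-power (suc k) x y = trans (*-cong (τ-power k x y) (*-cong (τ-power k x y) (τ-power k x y)))
    (trans (solve 2 (λ X Y → :- (X :* Y) :* (:- (X :* Y) :* :- (X :* Y)) := :- (X :* (X :* X) :* (Y :* (Y :* Y)))) refl _ _)
      (-‿cong (*-cong (sym (cube x (3 ℕ.^ k))) (sym (cube y (3 ℕ.^ k))))))
  σ-power zero    x y = +-cong (sym (*-identityʳ x)) (sym (*-identityʳ y))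
  σ-power (suc k) x y = trans (*-cong (σ-power k x y) (sixth-power k x y))
    (trans (solve 2 (λ X Y → (X :+ Y) :* (X :* X :- X :* Y :+ Y :* Y) := X :* (X :* X) :+ Y :* (Y :* Y)) refl _ _)
      (+-cong (sym (cube x (3 ℕ.^ k))) (sym (cube y (3 ℕ.^ k)))))
  sixth-power k x y = trans (+-cong (*-cong (σ-power k x y) (σ-power k x y))
      (+-cong (τ-power k x y) (+-cong (τ-power k x y) (τ-power k x y))))
    (solve 2 (λ X Y → (X :+ Y) :* (X :+ Y) :+ (:- (X :* Y) :+ (:- (X :* Y) :+ :- (X :* Y))) :=
      X :* X :- X :* Y :+ Y :* Y) refl _ _)

  module LucasAtom {n : ℕ} (1≤n : 1 ℕ.≤ n) (ω : Carrier) (prim : IsPrimitiveRoot K n ω) (P : List (List ℤ))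
              (atom : RawRing._≈_ (K[α,β] K) (substituted K P) (Φ K n ω)) where
    open PrimitiveRoot K char0 1≤n ω prim

    product : List ℕ → Carrier → Carrier → Carrier
    product js x y = foldr _*_ 1# (map (λ j → x - ω ^ j * y) js)

    product-homogeneous : ∀ z x y js → product js (z * x) (z * y) ≈ z ^ length js * product js x y
    product-homogeneous z x y []       = sym (*-identityˡ 1#)
    product-homogeneous z x y (j ∷ js) = trans (*-congˡ (product-homogeneous z x y js))
      (solve 6 (λ z x y w u v → (z :* x :- w :* (z :* y)) :* (u :* v) := z :* u :* ((x :- w :* y) :* v))
        refl z x y (ω ^ j) _ _)

    product-cong : ∀ js {x x′ y y′} → x ≈ x′ → y ≈ y′ → product js x y ≈ product js x′ y′
    product-cong []       x≈ y≈ = refl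
    product-cong (j ∷ js) x≈ y≈ = *-cong (+-cong x≈ (-‿cong (*-congˡ y≈))) (product-cong js x≈ y≈)

    ι-value : ∀ {s t x y} → ι K s ≈ x + y → ι K t ≈ - (x * y) → ι K (P ⟨ s , t ⟩) ≈ product (coprimesUpTo n) x y
    ι-value {s} {t} {x} {y} s≈ t≈ = trans
      (evaluate₂-natural +-*-rawRing (commutativeRing K) (ι K) (ι-isHomomorphism K) id (ι K) (λ _ → refl) P {s} {t} s≈ t≈)
      (value-product K char0 n ω P atom x y)

    ι-value-split : ∀ s y → ι K (P ⟨ s , y ℤ.* (y ℤ.- s) ⟩) ≈ product (coprimesUpTo n) (ι K s - ι K y) (ι K y)
    ι-value-split s y = ι-value {s} {y ℤ.* (y ℤ.- s)}
      (solve 2 (λ s y → s := (s :- y) :+ y) refl (ι K s) (ι K y))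
      (trans (ι-* K y (y ℤ.- s)) (trans (*-congˡ (trans (ι-+ K y (ℤ.- s)) (+-congˡ (ι-neg K s))))
        (solve 2 (λ s y → y :* (y :- s) := :- ((s :- y) :* y)) refl (ι K s) (ι K y))))

    -- Scaling x and y by z multiplies each of the φ n linear factors by z. It is stated at split
    -- points, where the product is available.
    homogeneous : ∀ z s y → P ⟨ z ℤ.* s , (z ℤ.* y) ℤ.* (z ℤ.* y ℤ.- z ℤ.* s) ⟩ ≡
                            z ℤ.^ φ n ℤ.* P ⟨ s , y ℤ.* (y ℤ.- s) ⟩
    homogeneous z s y = ι-injective (begin
      ι K (P ⟨ z ℤ.* s , (z ℤ.* y) ℤ.* (z ℤ.* y ℤ.- z ℤ.* s) ⟩)
        ≈⟨ ι-value-split (z ℤ.* s) (z ℤ.* y) ⟩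
      product js (ι K (z ℤ.* s) - ι K (z ℤ.* y)) (ι K (z ℤ.* y))
        ≈⟨ product-cong js (trans (+-cong (ι-* K z s) (-‿cong (ι-* K z y)))
             (solve 3 (λ z s y → z :* s :- z :* y := z :* (s :- y)) refl _ _ _)) (ι-* K z y) ⟩
      product js (ι K z * (ι K s - ι K y)) (ι K z * ι K y)
        ≈⟨ product-homogeneous (ι K z) _ _ js ⟩
      ι K z ^ φ n * product js (ι K s - ι K y) (ι K y)
        ≈⟨ *-cong (ι-^ z (φ n)) (ι-value-split s y) ⟨
      ι K (z ℤ.^ φ n) * ι K (P ⟨ s , y ℤ.* (y ℤ.- s) ⟩)
        ≈⟨ ι-* K (z ℤ.^ φ n) _ ⟨
      ι K (z ℤ.^ φ n ℤ.* P ⟨ s , y ℤ.* (y ℤ.- s) ⟩) ∎)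
      where js = coprimesUpTo n

    -- For each x, homogeneity makes the defect with μ = 1 and c = x ^ φ n vanish at all samples y
    -- (y - 1), so its coefficients in t are zero.
    isobaric : Isobaric (φ n) P
    isobaric = defect≡0⇒isobaric (ℤ._^ φ n) (λ _ → ℤ.1ℤ) (φ n) P (λ _ _ ()) (λ x → ≡.sym (ℤₚ.*-identityˡ _))
      λ x _ → samples⇒≡0 ℤ.1ℤ _ λ k → ≡.trans
        (homogeneityDefect-value x (x ℤ.^ φ n) ℤ.1ℤ P (sample ℤ.1ℤ k))
        (ℤₚ.i≡j⇒i-j≡0 (≡.trans (ℤₚ.*-identityˡ _) (scaled x (ordinate ℤ.1ℤ k))))
      where
      open ℤSolver.+-*-Solver using () renaming (solve to solveℤ; _:=_ to _⊜_; _:*_ to _⊗_; _:-_ to _⊖_; con to κ)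
      scaled : ∀ x y → P ⟨ x , x ℤ.* x ℤ.* (y ℤ.* (y ℤ.- ℤ.1ℤ)) ⟩ ≡ x ℤ.^ φ n ℤ.* P ⟨ ℤ.1ℤ , y ℤ.* (y ℤ.- ℤ.1ℤ) ⟩
      scaled x y = ≡.trans (≡.cong₂ (λ s t → P ⟨ s , t ⟩) (≡.sym (ℤₚ.*-identityʳ x))
        (solveℤ 2 (λ x y → x ⊗ x ⊗ (y ⊗ (y ⊖ κ ℤ.1ℤ)) ⊜ x ⊗ y ⊗ (x ⊗ y ⊖ x ⊗ κ ℤ.1ℤ)) ≡.refl x y))
        (homogeneous x ℤ.1ℤ y)

    -- P (X + 1 , − X) = Φₙ(X , 1).
    dehomogenized : List ℤ
    dehomogenized = evaluate₂ Pℤ.rawRing Pℤ.const P (Pℤ.add Pℤ.X (Pℤ.const ℤ.1ℤ)) (map (ℤ.-_) Pℤ.X)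

    dehomogenized-value : ∀ x → ⟦ dehomogenized ⟧ℤ x ≈ evaluate₂ rawRing (ι K) P (x + 1#) (- (x * 1#))
    dehomogenized-value x = evaluate₂-natural Pℤ.rawRing (commutativeRing K) (Eℤ.eval x) (Eℤ.eval-isHomomorphism x)
      Pℤ.const (ι K) (Eℤ.eval-const x) P {u = Pℤ.add Pℤ.X (Pℤ.const ℤ.1ℤ)} {v = map (ℤ.-_) Pℤ.X}
      (trans (Eℤ.eval-add x Pℤ.X (Pℤ.const ℤ.1ℤ)) (+-cong (Eℤ.eval-X x) (trans (Eℤ.eval-const x ℤ.1ℤ) (+-identityʳ 1#))))
      (trans (Eℤ.eval-neg x Pℤ.X) (-‿cong (trans (Eℤ.eval-X x) (sym (*-identityʳ x)))))

    product-linearProduct : ∀ x js → product js x 1# ≈ linearProduct (map (ω ^_) js) x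
    product-linearProduct x []       = refl
    product-linearProduct x (j ∷ js) = *-cong (+-congˡ (-‿cong (*-identityʳ _))) (product-linearProduct x js)

    -- The quotient has integer coefficients, so the divisibility survives evaluation at X = 2,
    -- where the divisor takes the value at (2 + 1 , - 2 · 1).
    value-∣-geometric : ∀ {k p} → n ≡ k ℕ.* p → 1 ℕ.≤ k → 1 ℕ.< p →
      P ⟨ + 3 , ℤ.- (+ 2) ⟩ ∣ˢ value (geometric k p) (+ 2)
    value-∣-geometric {k} {p} n≡kp 1≤k 1<p = divides (value (proj₁ quotient′) (+ 2)) (ι-injective (begin
      ι K (value (geometric k p) (+ 2))  ≈⟨ ι-evaluate (geometric k p) (+ 2) ⟩
      ⟦ geometric k p ⟧ℤ (ι K (+ 2))     ≈⟨ proj₂ quotient′ (ι K (+ 2)) ⟩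
      ⟦ proj₁ quotient′ ⟧ℤ (ι K (+ 2)) * ⟦ dehomogenized ⟧ℤ (ι K (+ 2))
        ≈⟨ *-cong (sym (ι-evaluate (proj₁ quotient′) (+ 2)))
             (trans (dehomogenized-value (ι K (+ 2))) (trans (value-product K char0 n ω P atom _ _)
               (sym (ι-value {+ 3} {ℤ.- (+ 2)} 3≈2+1 -2≈-[2*1])))) ⟩
      ι K (value (proj₁ quotient′) (+ 2)) * ι K (P ⟨ + 3 , ℤ.- (+ 2) ⟩) ≈⟨ ι-* K (value (proj₁ quotient′) (+ 2)) _ ⟨
      ι K (value (proj₁ quotient′) (+ 2) ℤ.* P ⟨ + 3 , ℤ.- (+ 2) ⟩) ∎))
      where
      quotient′ : ∃[ q ] (∀ x → ⟦ geometric k p ⟧ℤ x ≈ ⟦ q ⟧ℤ x * ⟦ dehomogenized ⟧ℤ x)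
      quotient′ = linearProduct-∣ roots dehomogenized
        (λ x → trans (dehomogenized-value x) (trans (value-product K char0 n ω P atom x 1#)
          (product-linearProduct x (coprimesUpTo n))))
        roots-distinct (geometric k p) (geometric-roots n≡kp 1≤k 1<p)
      3≈2+1 : ι K (+ 3) ≈ ι K (+ 2) + 1#
      3≈2+1 = +-comm _ _
      -2≈-[2*1] : ι K (ℤ.- (+ 2)) ≈ - (ι K (+ 2) * 1#)
      -2≈-[2*1] = -‿cong (sym (*-identityʳ _))

    ordinate≉0 : ∀ s k → ¬ ι K (ordinate s k) ≈ 0#
    ordinate≉0 s k = char0 (suc (ℤ.∣ s ∣ ℕ.+ k)) (s≤s z≤n)

    -- Φₙ(x , y) = Φ₆(xᴹ , yᴹ): both are monic of degree φ n = 2 M in x, with the same roots.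
    module SixTimes {M : ℕ} (1≤M : 1 ℕ.≤ M) (n≡6M : n ≡ M ℕ.* 6) (φn≡2M : φ n ≡ M ℕ.* 2) where
      -- The solver's constant 1 denotes the image of the integer 1, which is 1 + 0 in `K` and not 1
      -- by definition.
      𝟙 : Carrier
      𝟙 = ι K ℤ.1ℤ

      𝟙≈1 : 𝟙 ≈ 1#
      𝟙≈1 = +-identityʳ 1#

      x^M*i≉1 : ∀ i → 1 ℕ.≤ i → i ℕ.< 6 → ∀ {j} → gcd j n ≡ 1 → ¬ (ω ^ j) ^ (M ℕ.* i) ≈ 1#
      x^M*i≉1 i 1≤i i<6 {j} gcd≡1 eq = ℕₚ.<⇒≱ (≡.subst (M ℕ.* i ℕ.<_) (≡.sym n≡6M) (ℕₚ.*-monoʳ-< M i<6))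
        (∣ℕ.∣⇒≤ ([ω^j]^k≈1⇒n∣k {j} (M ℕ.* i) gcd≡1 eq))
        where
        instance
          M≢0 = ℕ.>-nonZero 1≤M
          i≢0 = ℕ.>-nonZero 1≤i
          Mi≢0 = ℕₚ.m*n≢0 M i

      -- z = (ωʲ)ᴹ satisfies z⁶ = 1 but neither z³ = 1 nor z² = 1. In z⁶ - 1 = (z³ - 1) (z + 1) (z²
      -- - z + 1) the first two factors can therefore be cancelled.
      sixth-root : ∀ {j} → gcd j n ≡ 1 → (ω ^ j) ^ M * (ω ^ j) ^ M - (ω ^ j) ^ M + 𝟙 ≈ 0#
      sixth-root {j} gcd≡1 = x*y≈0⇒y≈0 K z+1≉0 (begin
        (z + 𝟙) * (z * z - z + 𝟙)
          ≈⟨ solve 1 (λ z → (z :+ con ℤ.1ℤ) :* (z :* z :- z :+ con ℤ.1ℤ) := z :* (z :* z) :+ con ℤ.1ℤ) refl z ⟩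
        z * (z * z) + 𝟙
          ≈⟨ x*y≈0⇒y≈0 K z³-1≉0 (begin
               (z * (z * z) - 𝟙) * (z * (z * z) + 𝟙)
                 ≈⟨ solve 1 (λ z → (z :* (z :* z) :- con ℤ.1ℤ) :* (z :* (z :* z) :+ con ℤ.1ℤ) :=
                      z :* (z :* (z :* (z :* (z :* (z :* con ℤ.1ℤ))))) :- con ℤ.1ℤ) refl z ⟩
               z * (z * (z * (z * (z * (z * 𝟙))))) - 𝟙
                 ≈⟨ x≈y⇒x-y≈0 (trans (*-congˡ (*-congˡ (*-congˡ (*-congˡ (*-congˡ (*-congˡ 𝟙≈1))))))
                      (trans (^-assocʳ (ω ^ j) M 6) (trans (reflexive (≡.cong ((ω ^ j) ^_) (≡.sym n≡6M)))
                        (trans ([ω^j]^n≈1 j) (sym 𝟙≈1))))) ⟩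
               0# ∎) ⟩
        0# ∎)
        where
        z = (ω ^ j) ^ M
        z³-1≉0 : ¬ z * (z * z) - 𝟙 ≈ 0#
        z³-1≉0 eq = x^M*i≉1 3 (s≤s z≤n) (s≤s (s≤s (s≤s (s≤s z≤n)))) {j} gcd≡1 (trans (sym (^-assocʳ (ω ^ j) M 3))
          (trans (*-congˡ (*-congˡ (*-identityʳ z))) (trans (x-y≈0⇒x≈y eq) 𝟙≈1)))
        z+1≉0 : ¬ z + 𝟙 ≈ 0#
        z+1≉0 eq = x^M*i≉1 2 (s≤s z≤n) (s≤s (s≤s (s≤s z≤n))) {j} gcd≡1 (trans (sym (^-assocʳ (ω ^ j) M 2))
          (trans (*-congˡ (*-identityʳ z)) (trans (x-y≈0⇒x≈y (trans
            (solve 1 (λ z → z :* z :- con ℤ.1ℤ := (z :+ con ℤ.1ℤ) :* (z :- con ℤ.1ℤ)) refl z)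
            (x*x′≈0 _ eq))) 𝟙≈1)))

      -- The roots in x are ωʲ y, and they are distinct only because y is nonzero.
      product-sixth : ∀ x {y} → ¬ y ≈ 0# → product (coprimesUpTo n) x y ≈ x ^ M * x ^ M - x ^ M * y ^ M + y ^ M * y ^ M
      product-sixth x {y} y≉0 = begin
        product js x y                                ≈⟨ product-linear js ⟩
        linearProduct rs x                            ≈⟨ monic≈linearProduct rs p length-p rs-distinct p-roots x ⟨
        x ^ length rs + ⟦ p ⟧ x                       ≈⟨ p-value x ⟩
        x ^ M * x ^ M + (y ^ M * y ^ M - x ^ M * y ^ M)
          ≈⟨ solve 3 (λ a b c → a :+ (b :- c) := a :- c :+ b) refl _ _ _ ⟩
        x ^ M * x ^ M - x ^ M * y ^ M + y ^ M * y ^ M ∎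
        where
        js = coprimesUpTo n
        rs = map (λ j → ω ^ j * y) js
        M′ = ℕ.pred M
        -- The part of X ^ (2 M) - Xᴹ yᴹ + y ^ (2 M) below the leading term; the M - 1 zeros put -
        -- yᴹ at Xᴹ. Its length M + 1 is at most 2 M since M ≥ 1.
        p = y ^ M * y ^ M ∷ replicate M′ 0# ++ - (y ^ M) ∷ []

        M≡ : suc M′ ≡ M
        M≡ = ℕₚ.suc-pred M {{ℕ.>-nonZero 1≤M}}

        length-rs : length rs ≡ M ℕ.* 2
        length-rs = ≡.trans (Listₚ.length-map _ js) φn≡2M

        product-linear : ∀ js → product js x y ≈ linearProduct (map (λ j → ω ^ j * y) js) x
        product-linear []       = refl
        product-linear (j ∷ js) = *-congˡ (product-linear js)

        length-p : length p ℕ.≤ length rs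
        length-p = ℕₚ.≤-trans (ℕₚ.≤-reflexive (≡.trans (≡.cong suc (≡.trans (Listₚ.length-++ (replicate M′ 0#))
            (≡.trans (ℕₚ.+-comm _ 1) (≡.cong suc (Listₚ.length-replicate M′))))) (≡.cong suc M≡)))
          (ℕₚ.≤-trans (≡.subst (suc M ℕ.≤_) (≡.trans (≡.cong (M ℕ.+_) (≡.sym (ℕₚ.+-identityʳ M))) (ℕₚ.*-comm 2 M))
            (ℕₚ.+-monoˡ-≤ M 1≤M)) (ℕₚ.≤-reflexive (≡.sym length-rs)))

        p-value : ∀ x → x ^ length rs + ⟦ p ⟧ x ≈ x ^ M * x ^ M + (y ^ M * y ^ M - x ^ M * y ^ M)
        p-value x = +-cong
          (trans (reflexive (≡.cong (x ^_) length-rs)) (trans (sym (^-assocʳ x M 2)) (*-congˡ (*-identityʳ _))))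
          (+-congˡ (begin
            x * ⟦ replicate M′ 0# ++ - (y ^ M) ∷ [] ⟧ x
              ≈⟨ *-congˡ (Evaluation.eval-shift rawRing (commutativeRing K) id
                   (id-isHomomorphism (commutativeRing K)) x M′ _) ⟩
            x * (x ^ M′ * (- (y ^ M) + x * 0#))
              ≈⟨ trans (sym (*-assoc x _ _)) (*-cong (reflexive (≡.cong (x ^_) M≡)) (trans (+-congˡ (zeroʳ x)) (+-identityʳ _))) ⟩
            x ^ M * - (y ^ M)  ≈⟨ -‿distribʳ-* _ _ ⟨
            - (x ^ M * y ^ M)  ∎))

        rs-distinct : AllPairs (λ r r′ → ¬ r ≈ r′) rs
        rs-distinct = AllPairsₚ.map⁺ (AllPairs.map (λ {i} {j} i≉j eq → i≉j (x-y≈0⇒x≈y (x*y≈0⇒y≈0 K y≉0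
          (trans (solve 3 (λ y u v → y :* (u :- v) := u :* y :- v :* y) refl y (ω ^ i) (ω ^ j)) (x≈y⇒x-y≈0 eq)))))
          powers-distinct)

        p-roots : All (λ r → r ^ length rs + ⟦ p ⟧ r ≈ 0#) rs
        p-roots = Allₚ.map⁺ (All.map (λ {j} gcd≡1 → begin
          (ω ^ j * y) ^ length rs + ⟦ p ⟧ (ω ^ j * y)  ≈⟨ p-value (ω ^ j * y) ⟩
          (ω ^ j * y) ^ M * (ω ^ j * y) ^ M + (y ^ M * y ^ M - (ω ^ j * y) ^ M * y ^ M)
            ≈⟨ +-cong (*-cong (^-distrib-* (ω ^ j) y M) (^-distrib-* (ω ^ j) y M))
                 (+-congˡ (-‿cong (*-congʳ (^-distrib-* (ω ^ j) y M)))) ⟩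
          (ω ^ j) ^ M * y ^ M * ((ω ^ j) ^ M * y ^ M) + (y ^ M * y ^ M - (ω ^ j) ^ M * y ^ M * y ^ M)
            ≈⟨ solve 2 (λ z y → z :* y :* (z :* y) :+ (y :* y :- z :* y :* y) :=
                 (z :* z :- z :+ con ℤ.1ℤ) :* (y :* y)) refl ((ω ^ j) ^ M) (y ^ M) ⟩
          ((ω ^ j) ^ M * (ω ^ j) ^ M - (ω ^ j) ^ M + 𝟙) * (y ^ M * y ^ M)
            ≈⟨ x*x′≈0 _ (sixth-root {j} gcd≡1) ⟩
          0# ∎) (coprimesUpTo-coprime n))

    -- Known at the samples from `product-sixth`. To extend it to all t, the cube map is also run
    -- over ℤ[X] with X in place of t, which supplies the polynomial B to compare with.
    value-sixth : ∀ k → n ≡ 3 ℕ.^ k ℕ.* 6 → φ n ≡ 3 ℕ.^ k ℕ.* 2 → ∀ s t → P ⟨ s , t ⟩ ≡ Cℤ.sixth k s t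
    value-sixth k n≡ φn≡ s t = ≡.trans
      (agreement⇒≡ P B s (λ i → ≡.trans (agree i) (≡.sym (B-value (sample s i)))) t)
      (B-value t)
      where
      B = CubeMap.sixth Pℤ.rawRing k (Pℤ.const s) Pℤ.X

      B-value : ∀ t → value B t ≡ Cℤ.sixth k s t
      B-value t = sixth-natural Pℤ.rawRing ℤ-ring (λ p → value p t) (value-isHomomorphism t) k
        {Pℤ.const s} {Pℤ.X} (V.eval-const s) V.eval-X
        where module V = Evaluation +-*-rawRing ℤ-ring id (id-isHomomorphism ℤ-ring) t

      agree : ∀ i → P ⟨ s , sample s i ⟩ ≡ Cℤ.sixth k s (sample s i)
      agree i = ι-injective (begin
        ι K (P ⟨ s , sample s i ⟩)                          ≈⟨ ι-value-split s (ordinate s i) ⟩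
        product (coprimesUpTo n) x y                        ≈⟨ SixTimes.product-sixth (ℕₚ.m^n>0 3 k) n≡ φn≡ x (ordinate≉0 s i) ⟩
        _                                                   ≈⟨ sixth-power k x y ⟨
        C.sixth k (x + y) (- (x * y))
          ≈⟨ sixth-natural +-*-rawRing (commutativeRing K) (ι K) (ι-isHomomorphism K) k {s} {sample s i}
               (solve 2 (λ s y → s := (s :- y) :+ y) refl (ι K s) y)
               (trans (ι-* K (ordinate s i) (ordinate s i ℤ.- s))
                 (trans (*-congˡ (trans (ι-+ K (ordinate s i) (ℤ.- s)) (+-congˡ (ι-neg K s))))
                 (solve 2 (λ s y → y :* (y :- s) := :- ((s :- y) :* y)) refl (ι K s) y))) ⟨
        ι K (Cℤ.sixth k s (sample s i))                     ∎)
        where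
        y = ι K (ordinate s i)
        x = ι K s - y

    -- Here ω = -1, as ω² = 1 and ω differs from 1, so the single factor x - ω y is x + y = s.
    value-second : n ≡ 2 → ∀ s t → P ⟨ s , t ⟩ ≡ s
    value-second ≡.refl s t = ≡.trans
      (agreement⇒≡ P (Pℤ.const s) s (λ i → ≡.trans (agree i) (≡.sym (B-value (sample s i)))) t)
      (B-value t)
      where
      B-value : ∀ t → value (Pℤ.const s) t ≡ s
      B-value t = Evaluation.eval-const +-*-rawRing ℤ-ring id (id-isHomomorphism ℤ-ring) t s

      ω+1≈0 : ω + 1# ≈ 0#
      ω+1≈0 = x*y≈0⇒y≈0 K
        (λ ω-1≈0 → proj₂ prim 1 (s≤s z≤n) (s≤s (s≤s z≤n)) (trans (*-identityʳ ω) (x-y≈0⇒x≈y ω-1≈0)))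
        (trans (solve 2 (λ w u → (w :- u) :* (w :+ u) := w :* w :- u :* u) refl ω 1#)
          (x≈y⇒x-y≈0 (trans (*-congˡ (sym (*-identityʳ ω))) (trans ω^n≈1 (sym (*-identityʳ 1#))))))

      agree : ∀ i → P ⟨ s , sample s i ⟩ ≡ s
      agree i = ι-injective (begin
        ι K (P ⟨ s , sample s i ⟩)               ≈⟨ ι-value-split s (ordinate s i) ⟩
        (ι K s - y - ω ^ 1 * y) * 1#
          ≈⟨ trans (*-identityʳ _) (+-congˡ (-‿cong (*-congʳ (*-identityʳ ω)))) ⟩
        ι K s - y - ω * y
          ≈⟨ +-congʳ (+-congˡ (-‿cong (sym (*-identityˡ y)))) ⟩
        ι K s - 1# * y - ω * y
          ≈⟨ solve 4 (λ s y w u → s :- u :* y :- w :* y := s :- (w :+ u) :* y) refl (ι K s) y ω 1# ⟩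
        ι K s - (ω + 1#) * y                     ≈⟨ +-congˡ (trans (-‿cong (x*x′≈0 y ω+1≈0)) -0#≈0#) ⟩
        ι K s + 0#                               ≈⟨ +-identityʳ _ ⟩
        ι K s                                    ∎)
        where y = ι K (ordinate s i)

-- Factoring out 3s, and counting residues for φ (3ᵏ · 6).

parity : ∀ n → ∃[ q ] (n ≡ q ℕ.* 2 ⊎ n ≡ suc (q ℕ.* 2))
parity zero          = 0 , inj₁ ≡.refl
parity (suc zero)    = 0 , inj₂ ≡.refl
parity (suc (suc n)) with parity n
... | q , inj₁ eq = suc q , inj₁ (≡.cong (suc ∘ suc) eq)
... | q , inj₂ eq = suc q , inj₂ (≡.cong (suc ∘ suc) eq)

extract-3s : ∀ m → 1 ℕ.≤ m → ∃[ e ] ∃[ u ] m ≡ 3 ℕ.^ e ℕ.* u × ¬ 3 ∣ℕ.∣ u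
extract-3s = <-rec _ step
  where
  step : ∀ m → (∀ {q} → q ℕ.< m → 1 ℕ.≤ q → ∃[ e ] ∃[ u ] q ≡ 3 ℕ.^ e ℕ.* u × ¬ 3 ∣ℕ.∣ u) →
         1 ℕ.≤ m → ∃[ e ] ∃[ u ] m ≡ 3 ℕ.^ e ℕ.* u × ¬ 3 ∣ℕ.∣ u
  step m rec 1≤m with 3 ∣ℕ.∣? m
  ... | no 3∤m = 0 , m , ≡.sym (ℕₚ.*-identityˡ m) , 3∤m
  ... | yes (∣ℕ.divides zero eq) = contradiction eq (ℕₚ.>⇒≢ 1≤m)
  ... | yes (∣ℕ.divides q@(suc _) ≡.refl) with rec (ℕₚ.m<m*n q 3 (s≤s (s≤s z≤n))) (s≤s z≤n)
  ... | e , u , eq , 3∤u = suc e , u ,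
    ≡.trans (ℕₚ.*-comm q 3) (≡.trans (≡.cong (3 ℕ.*_) eq) (≡.sym (ℕₚ.*-assoc 3 (3 ℕ.^ e) u))) , 3∤u

coprime-* : ∀ {j m n} → Coprimality.Coprime j m → Coprimality.Coprime j n → Coprimality.Coprime j (m ℕ.* n)
coprime-* {j} {m} {n} j⊥m j⊥n {d} (d∣j , d∣mn) = j⊥n (d∣j ,
  Coprimality.coprime-divisor {d} {m} (λ (e∣d , e∣m) → j⊥m (∣ℕ.∣-trans e∣d d∣j , e∣m)) d∣mn)

coprime-^ : ∀ {j m} k → Coprimality.Coprime j m → Coprimality.Coprime j (m ℕ.^ k)
coprime-^ zero    j⊥m (_ , d∣1) = ∣ℕ.∣1⇒≡1 d∣1
coprime-^ {j} {m} (suc k) j⊥m = coprime-* {j} {m} {m ℕ.^ k} j⊥m (coprime-^ {j} {m} k j⊥m)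

coprime-1+ : ∀ {j m} → m ∣ℕ.∣ j → Coprimality.Coprime (suc j) m
coprime-1+ {j} m∣j {d} (d∣1+j , d∣m) = ∣ℕ.∣1⇒≡1
  (∣ℕ.∣m+n∣m⇒∣n (≡.subst (d ∣ℕ.∣_) (ℕₚ.+-comm 1 j) d∣1+j) (∣ℕ.∣-trans d∣m m∣j))

coprime-∸1 : ∀ {j m} → m ∣ℕ.∣ suc j → Coprimality.Coprime j m
coprime-∸1 {j} m∣1+j {d} (d∣j , d∣m) = ∣ℕ.∣1⇒≡1
  (∣ℕ.∣m+n∣m⇒∣n (≡.subst (d ∣ℕ.∣_) (ℕₚ.+-comm 1 j) (∣ℕ.∣-trans d∣m m∣1+j)) d∣j)

-- Positions start at 0 and `f` will be `suc`, so the accepted positions 0 and 4 are the residues 1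
-- and 5 modulo 6. An arbitrary `f` lets the induction shift by six.
length-filter-period-6 : ∀ {ℓ} {Q : ℕ → Set ℓ} (Q? : Decidable Q) M (f : ℕ → ℕ) →
  (∀ i → Q (f (i ℕ.* 6))) → (∀ i → ¬ Q (f (1 ℕ.+ i ℕ.* 6))) → (∀ i → ¬ Q (f (2 ℕ.+ i ℕ.* 6))) →
  (∀ i → ¬ Q (f (3 ℕ.+ i ℕ.* 6))) → (∀ i → Q (f (4 ℕ.+ i ℕ.* 6))) → (∀ i → ¬ Q (f (5 ℕ.+ i ℕ.* 6))) →
  length (filter Q? (applyUpTo f (M ℕ.* 6))) ≡ M ℕ.* 2
length-filter-period-6 Q? zero    f q₀ q₁ q₂ q₃ q₄ q₅ = ≡.refl
length-filter-period-6 Q? (suc M) f q₀ q₁ q₂ q₃ q₄ q₅ = begin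
  length (filter Q? (applyUpTo f (suc M ℕ.* 6)))  ≡⟨ ≡.cong length (Listₚ.filter-accept Q? (q₀ 0)) ⟩
  suc (length (filter Q? (applyUpTo (λ i → f (1 ℕ.+ i)) (5 ℕ.+ M ℕ.* 6))))
    ≡⟨ ≡.cong (suc ∘ length) (Listₚ.filter-reject Q? (q₁ 0)) ⟩
  suc (length (filter Q? (applyUpTo (λ i → f (2 ℕ.+ i)) (4 ℕ.+ M ℕ.* 6))))
    ≡⟨ ≡.cong (suc ∘ length) (Listₚ.filter-reject Q? (q₂ 0)) ⟩
  suc (length (filter Q? (applyUpTo (λ i → f (3 ℕ.+ i)) (3 ℕ.+ M ℕ.* 6))))
    ≡⟨ ≡.cong (suc ∘ length) (Listₚ.filter-reject Q? (q₃ 0)) ⟩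
  suc (length (filter Q? (applyUpTo (λ i → f (4 ℕ.+ i)) (2 ℕ.+ M ℕ.* 6))))
    ≡⟨ ≡.cong (suc ∘ length) (Listₚ.filter-accept Q? (q₄ 0)) ⟩
  suc (suc (length (filter Q? (applyUpTo (λ i → f (5 ℕ.+ i)) (1 ℕ.+ M ℕ.* 6)))))
    ≡⟨ ≡.cong (suc ∘ suc ∘ length) (Listₚ.filter-reject Q? (q₅ 0)) ⟩
  suc (suc (length (filter Q? (applyUpTo (λ i → f (6 ℕ.+ i)) (M ℕ.* 6)))))
    ≡⟨ ≡.cong (suc ∘ suc) (length-filter-period-6 Q? M (λ i → f (6 ℕ.+ i))
         (q₀ ∘ suc) (q₁ ∘ suc) (q₂ ∘ suc) (q₃ ∘ suc) (q₄ ∘ suc) (q₅ ∘ suc)) ⟩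
  suc M ℕ.* 2 ∎
  where open ≡-Reasoning

-- Being prime to 3ᵏ · 6 depends only on the residue modulo 6: next to a multiple of 6 a number is
-- prime to both 2 and 3, and each other residue shares one of these primes with n.
φ[3^k*6] : ∀ k → φ (3 ℕ.^ k ℕ.* 6) ≡ 3 ℕ.^ k ℕ.* 2
φ[3^k*6] k = ≡.trans (≡.cong (λ js → length (filter (λ j → gcd j n ℕₚ.≟ 1) js)) (Listₚ.map-upTo suc n))
  (length-filter-period-6 (λ j → gcd j n ℕₚ.≟ 1) (3 ℕ.^ k) suc
    (λ i → coprime (coprime-1+ (∣ℕ.divides (i ℕ.* 3) (halve i))) (coprime-1+ (∣ℕ.divides (i ℕ.* 2) (third i))))
    (λ i → ¬coprime 2≢1 (2∣ 1 i) 2∣n) (λ i → ¬coprime 3≢1 (3∣ 1 i) 3∣n) (λ i → ¬coprime 2≢1 (2∣ 2 i) 2∣n)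
    (λ i → coprime (coprime-∸1 (2∣ 3 i)) (coprime-∸1 (3∣ 2 i)))
    (λ i → ¬coprime 2≢1 (2∣ 3 i) 2∣n))
  where
  n = 3 ℕ.^ k ℕ.* 6

  2≢1 : 2 ≢ 1
  2≢1 ()

  3≢1 : 3 ≢ 1
  3≢1 ()

  halve : ∀ i → i ℕ.* 6 ≡ i ℕ.* 3 ℕ.* 2
  halve i = ≡.sym (ℕₚ.*-assoc i 3 2)

  third : ∀ i → i ℕ.* 6 ≡ i ℕ.* 2 ℕ.* 3
  third i = ≡.sym (ℕₚ.*-assoc i 2 3)

  2∣ : ∀ r i → 2 ∣ℕ.∣ r ℕ.* 2 ℕ.+ i ℕ.* 6
  2∣ r i = ∣ℕ.∣m∣n⇒∣m+n (∣ℕ.n∣m*n r) (∣ℕ.divides (i ℕ.* 3) (halve i))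

  3∣ : ∀ r i → 3 ∣ℕ.∣ r ℕ.* 3 ℕ.+ i ℕ.* 6
  3∣ r i = ∣ℕ.∣m∣n⇒∣m+n (∣ℕ.n∣m*n r) (∣ℕ.divides (i ℕ.* 2) (third i))

  2∣n : 2 ∣ℕ.∣ n
  2∣n = 2∣ 0 (3 ℕ.^ k)

  3∣n : 3 ∣ℕ.∣ n
  3∣n = 3∣ 0 (3 ℕ.^ k)

  coprime : ∀ {j} → Coprimality.Coprime j 2 → Coprimality.Coprime j 3 → gcd j n ≡ 1
  coprime {j} j⊥2 j⊥3 = Coprimality.coprime⇒gcd≡1 {j} {n}
    (coprime-* {j} {3 ℕ.^ k} {6} (coprime-^ {j} {3} k j⊥3) (coprime-* {j} {2} {3} j⊥2 j⊥3))

  ¬coprime : ∀ {j d} → d ≢ 1 → d ∣ℕ.∣ j → d ∣ℕ.∣ n → ¬ gcd j n ≡ 1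
  ¬coprime {j} d≢1 d∣j d∣n gcd≡1 = d≢1 (Coprimality.gcd≡1⇒coprime {j} {n} gcd≡1 (d∣j , d∣n))

-- Divisibility by 3 of the geometric quotients at X = 2.

3-prime : Prime 3
3-prime = from-yes (prime? 3)

3∤* : ∀ {i j} → ¬ + 3 ∣ˢ i → ¬ + 3 ∣ˢ j → ¬ + 3 ∣ˢ i ℤ.* j
3∤* {i} {j} 3∤i 3∤j 3∣ij with euclidsLemma ℤ.∣ i ∣ ℤ.∣ j ∣ 3-prime
  (≡.subst (3 ∣ℕ.∣_) (ℤₚ.abs-* i j) (∣ℤ.∣⇒∣ᵤ 3∣ij))
... | inj₁ 3∣i = 3∤i (∣ℤ.∣ᵤ⇒∣ 3∣i)
... | inj₂ 3∣j = 3∤j (∣ℤ.∣ᵤ⇒∣ 3∣j)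

3∤1 : ¬ + 3 ∣ˢ ℤ.1ℤ
3∤1 3∣1 = contradiction (∣ℕ.∣⇒≤ (∣ℤ.∣⇒∣ᵤ 3∣1)) λ { (s≤s ()) }

3∤^ : ∀ {i} k → ¬ + 3 ∣ˢ i → ¬ + 3 ∣ˢ i ℤ.^ k
3∤^ zero    3∤i = 3∤1
3∤^ (suc k) 3∤i = 3∤* 3∤i (3∤^ k 3∤i)

3∤+3* : ∀ {i} w → ¬ + 3 ∣ˢ i → ¬ + 3 ∣ˢ i ℤ.+ + 3 ℤ.* w
3∤+3* w 3∤i 3∣ = 3∤i (∣ℤ.∣m+n∣n⇒∣m 3∣ (∣ℤ.∣m⇒∣m*n w ∣ℤ.∣-refl))

open Exp (CommutativeRing.commutativeSemiring ℤ-ring) using () renaming (_^_ to _^′_; ^-assocʳ to ^′-assoc)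

value-geometric : ∀ k p x → value (geometric k (suc p)) x ≡ ℤ.1ℤ ℤ.+ x ^′ k ℤ.* value (geometric k p) x
value-geometric k p x = ≡.trans (V.eval-add (ℤ.1ℤ ∷ []) (replicate k ℤ.0ℤ ++ geometric k p))
  (≡.cong₂ ℤ._+_ (V.eval-const ℤ.1ℤ) (V.eval-shift k (geometric k p)))
  where module V = Evaluation +-*-rawRing ℤ-ring id (id-isHomomorphism ℤ-ring) x

module _ {d : ℤ} where
  open ℤSolver.+-*-Solver

  ∣x-1⇒∣x^k-1 : ∀ k x → d ∣ˢ x ℤ.- ℤ.1ℤ → d ∣ˢ x ^′ k ℤ.- ℤ.1ℤ
  ∣x-1⇒∣x^k-1 zero    x d∣ = divides ℤ.0ℤ ≡.refl
  ∣x-1⇒∣x^k-1 (suc k) x d∣ = ≡.subst (d ∣ˢ_)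
    (solve 2 (λ x y → x :* (y :- con ℤ.1ℤ) :+ (x :- con ℤ.1ℤ) := x :* y :- con ℤ.1ℤ) ≡.refl x (x ^′ k))
    (∣ℤ.∣m∣n⇒∣m+n (∣ℤ.∣n⇒∣m*n x (∣x-1⇒∣x^k-1 k x d∣)) d∣)

  -- Each of the p terms is a power of xᵏ ≡ 1.
  geometric-≡p : ∀ k p x → d ∣ˢ x ^′ k ℤ.- ℤ.1ℤ → d ∣ˢ value (geometric k p) x ℤ.- + p
  geometric-≡p k zero    x d∣ = divides ℤ.0ℤ ≡.refl
  geometric-≡p k (suc p) x d∣ = ≡.subst (d ∣ˢ_) (begin
    (z ℤ.- ℤ.1ℤ) ℤ.* g ℤ.+ (g ℤ.- + p)
      ≡⟨ solve 3 (λ z g p → (z :- con ℤ.1ℤ) :* g :+ (g :- p) := con ℤ.1ℤ :+ z :* g :- (con ℤ.1ℤ :+ p)) ≡.refl z g (+ p) ⟩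
    ℤ.1ℤ ℤ.+ z ℤ.* g ℤ.- + suc p            ≡⟨ ≡.cong (ℤ._- + suc p) (value-geometric k p x) ⟨
    value (geometric k (suc p)) x ℤ.- + suc p ∎)
    (∣ℤ.∣m∣n⇒∣m+n (∣ℤ.∣m⇒∣m*n g d∣) (geometric-≡p k p x d∣))
    where
    open ≡-Reasoning
    z = x ^′ k
    g = value (geometric k p) x

  -- Since xᵏ ≡ -1, the terms alternate between 1 and -1, and an odd number of them leaves 1.
  geometric-odd-≡1 : ∀ k m x → d ∣ˢ x ^′ k ℤ.+ ℤ.1ℤ → d ∣ˢ value (geometric k (suc (m ℕ.* 2))) x ℤ.- ℤ.1ℤ
  geometric-odd-≡1 k zero x d∣ = divides ℤ.0ℤ (≡.trans (≡.cong (ℤ._- ℤ.1ℤ) (value-geometric k 0 x))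
    (solve 1 (λ z → con ℤ.1ℤ :+ z :* con ℤ.0ℤ :- con ℤ.1ℤ := con ℤ.0ℤ) ≡.refl (x ^′ k)))
  geometric-odd-≡1 k (suc m) x d∣ = ≡.subst (d ∣ˢ_) (begin
    (z ℤ.+ ℤ.1ℤ) ℤ.* (ℤ.1ℤ ℤ.+ (z ℤ.- ℤ.1ℤ) ℤ.* g) ℤ.+ (g ℤ.- ℤ.1ℤ)
      ≡⟨ solve 2 (λ z g → (z :+ con ℤ.1ℤ) :* (con ℤ.1ℤ :+ (z :- con ℤ.1ℤ) :* g) :+ (g :- con ℤ.1ℤ) :=
           con ℤ.1ℤ :+ z :* (con ℤ.1ℤ :+ z :* g) :- con ℤ.1ℤ) ≡.refl z g ⟩
    ℤ.1ℤ ℤ.+ z ℤ.* (ℤ.1ℤ ℤ.+ z ℤ.* g) ℤ.- ℤ.1ℤ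
      ≡⟨ ≡.cong (ℤ._- ℤ.1ℤ) (≡.trans (value-geometric k (suc (suc (m ℕ.* 2))) x)
           (≡.cong (λ g′ → ℤ.1ℤ ℤ.+ z ℤ.* g′) (value-geometric k (suc (m ℕ.* 2)) x))) ⟨
    value (geometric k (suc (suc m ℕ.* 2))) x ℤ.- ℤ.1ℤ ∎)
    (∣ℤ.∣m∣n⇒∣m+n (∣ℤ.∣m⇒∣m*n _ d∣) (geometric-odd-≡1 k m x d∣))
    where
    open ≡-Reasoning
    z = x ^′ k
    g = value (geometric k (suc (m ℕ.* 2))) x

3∤geometric-odd : ∀ m → ¬ + 3 ∣ˢ value (geometric 1 (suc (m ℕ.* 2))) (+ 2)
3∤geometric-odd m 3∣g = 3∤1 (≡.subst (+ 3 ∣ˢ_) (solve 1 (λ g → g :- (g :- con ℤ.1ℤ) := con ℤ.1ℤ) ≡.refl g)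
  (∣ℤ.∣m∣n⇒∣m-n 3∣g (geometric-odd-≡1 1 m (+ 2) ∣ℤ.∣-refl)))
  where
  open ℤSolver.+-*-Solver
  g = value (geometric 1 (suc (m ℕ.* 2))) (+ 2)

-- 2 ^ (2 k) = 4ᵏ ≡ 1 modulo 3, so the value is congruent to p.
3∤geometric-even : ∀ k {p} → ¬ 3 ∣ℕ.∣ p → ¬ + 3 ∣ˢ value (geometric (2 ℕ.* k) p) (+ 2)
3∤geometric-even k {p} 3∤p 3∣g = 3∤p (∣ℤ.∣⇒∣ᵤ (≡.subst (+ 3 ∣ˢ_) (solve 2 (λ g p → g :- (g :- p) := p) ≡.refl g (+ p))
  (∣ℤ.∣m∣n⇒∣m-n 3∣g (geometric-≡p (2 ℕ.* k) p (+ 2)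
    (≡.subst (λ z → + 3 ∣ˢ z ℤ.- ℤ.1ℤ) (^′-assoc (+ 2) 2 k) (∣x-1⇒∣x^k-1 k (+ 4) ∣ℤ.∣-refl))))))
  where
  open ℤSolver.+-*-Solver
  g = value (geometric (2 ℕ.* k) p) (+ 2)

-- Computing `v₃` from a factorization.

m<3^m : ∀ m → m ℕ.< 3 ℕ.^ m
m<3^m zero    = s≤s z≤n
m<3^m (suc m) = ℕₚ.≤-trans (s≤s (m<3^m m)) (≡.subst (3 ℕ.^ m ℕ.<_) (ℕₚ.*-comm (3 ℕ.^ m) 3)
  (ℕₚ.m<m*n (3 ℕ.^ m) 3 {{ℕₚ.m^n≢0 3 m}} (s≤s (s≤s z≤n))))

largestExponent-≡ : ∀ p m k e → (p ℕ.^ e) ∣ℕ.∣ m → (∀ i → e ℕ.< i → ¬ (p ℕ.^ i) ∣ℕ.∣ m) → e ℕ.≤ k →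
  largestExponent p m k ≡ e
largestExponent-≡ p m zero    .zero p^e∣m maximal z≤n = ≡.refl
largestExponent-≡ p m (suc k) e p^e∣m maximal e≤k with (p ℕ.^ suc k) ∣ℕ.∣? m
... | yes p^k∣m = ℕₚ.≤-antisym (ℕₚ.≮⇒≥ λ e<k → maximal (suc k) e<k p^k∣m) e≤k
... | no  p^k∤m = largestExponent-≡ p m k e p^e∣m maximal
  (ℕₚ.<⇒≤pred (ℕₚ.≤∧≢⇒< e≤k λ { ≡.refl → p^k∤m p^e∣m }))

v₃-nonzero : ∀ x m → ℤ.∣ x ∣ ≡ suc m → v₃ x ≡ [ largestExponent 3 (suc m) (suc m) ]
v₃-nonzero x m eq with ℤ.∣ x ∣ | eq
... | .(suc m) | ≡.refl = ≡.refl

v₃-abs : ∀ x e u → ℤ.∣ x ∣ ≡ 3 ℕ.^ e ℕ.* u → ¬ 3 ∣ℕ.∣ u → v₃ x ≡ [ e ]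
v₃-abs x e zero    eq 3∤u = contradiction (3 ∣ℕ.∣0) 3∤u
v₃-abs x e u@(suc _) eq 3∤u = ≡.trans (v₃-nonzero x (ℕ.pred ℤ.∣ x ∣) (≡.sym suc-pred))
  (≡.cong [_] (≡.trans (≡.cong (λ m → largestExponent 3 m m) suc-pred)
    (largestExponent-≡ 3 ℤ.∣ x ∣ ℤ.∣ x ∣ e (≡.subst (3 ℕ.^ e ∣ℕ.∣_) (≡.sym eq) (∣ℕ.m∣m*n u)) maximal e≤)))
  where
  instance 3^e≢0 = ℕₚ.m^n≢0 3 e
  3^e≤ : 3 ℕ.^ e ℕ.≤ ℤ.∣ x ∣
  3^e≤ = ≡.subst (3 ℕ.^ e ℕ.≤_) (≡.sym eq) (ℕₚ.m≤m*n (3 ℕ.^ e) u)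
  e≤ : e ℕ.≤ ℤ.∣ x ∣
  e≤ = ℕₚ.≤-trans (ℕₚ.<⇒≤ (m<3^m e)) 3^e≤
  suc-pred : suc (ℕ.pred ℤ.∣ x ∣) ≡ ℤ.∣ x ∣
  suc-pred = ℕₚ.suc-pred ℤ.∣ x ∣ {{ℕ.>-nonZero (ℕₚ.≤-trans (ℕₚ.m^n>0 3 e) 3^e≤)}}
  maximal : ∀ i → e ℕ.< i → ¬ (3 ℕ.^ i) ∣ℕ.∣ ℤ.∣ x ∣
  maximal i e<i 3^i∣x = 3∤u (∣ℕ.*-cancelˡ-∣ {3} {u} (3 ℕ.^ e) (≡.subst (3 ℕ.^ e ℕ.* 3 ∣ℕ.∣_) eq (∣ℕ.∣-trans
    (∣ℕ.divides (3 ℕ.^ (i ℕ.∸ suc e)) (begin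
      3 ℕ.^ i                                    ≡⟨ ≡.cong (3 ℕ.^_) (ℕₚ.m∸n+n≡m e<i) ⟨
      3 ℕ.^ (i ℕ.∸ suc e ℕ.+ suc e)              ≡⟨ ℕₚ.^-distribˡ-+-* 3 (i ℕ.∸ suc e) (suc e) ⟩
      3 ℕ.^ (i ℕ.∸ suc e) ℕ.* (3 ℕ.* 3 ℕ.^ e)    ≡⟨ ≡.cong (3 ℕ.^ (i ℕ.∸ suc e) ℕ.*_) (ℕₚ.*-comm 3 (3 ℕ.^ e)) ⟩
      3 ℕ.^ (i ℕ.∸ suc e) ℕ.* (3 ℕ.^ e ℕ.* 3)    ∎)) 3^i∣x)))
    where open ≡-Reasoning

v₃-unit : ∀ x e u → x ≡ + (3 ℕ.^ e) ℤ.* u → ¬ + 3 ∣ˢ u → v₃ x ≡ [ e ]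
v₃-unit x e u x≡ 3∤u = v₃-abs x e ℤ.∣ u ∣ (≡.trans (≡.cong ℤ.∣_∣ x≡) (ℤₚ.abs-* (+ (3 ℕ.^ e)) u)) (3∤u ∘ ∣ℤ.∣ᵤ⇒∣)

-- Here w may be 0, with both sides infinite. This matters for n = 6, where s′² + t′ can vanish.
v₃-scale : ∀ x k w → x ≡ + (3 ℕ.^ k) ℤ.* w → v₃ x ≡ k +⁺ v₃ w
v₃-scale x k w x≡ = byAbs ℤ.∣ w ∣ ≡.refl
  where
  byAbs : ∀ m → ℤ.∣ w ∣ ≡ m → v₃ x ≡ k +⁺ v₃ w
  byAbs zero eq = ≡.trans (≡.cong v₃ (≡.trans x≡ (≡.trans (≡.cong (+ (3 ℕ.^ k) ℤ.*_) w≡0) (ℤₚ.*-zeroʳ (+ (3 ℕ.^ k))))))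
    (≡.cong (λ w → k +⁺ v₃ w) (≡.sym w≡0))
    where
    w≡0 : w ≡ ℤ.0ℤ
    w≡0 = ℤₚ.∣i∣≡0⇒i≡0 eq
  byAbs (suc m) eq with extract-3s (suc m) (s≤s z≤n)
  ... | e , u , m≡ , 3∤u = ≡.trans (v₃-abs x (k ℕ.+ e) u (begin
    ℤ.∣ x ∣                             ≡⟨ ≡.trans (≡.cong ℤ.∣_∣ x≡) (ℤₚ.abs-* (+ (3 ℕ.^ k)) w) ⟩
    3 ℕ.^ k ℕ.* ℤ.∣ w ∣                 ≡⟨ ≡.cong (3 ℕ.^ k ℕ.*_) (≡.trans eq m≡) ⟩
    3 ℕ.^ k ℕ.* (3 ℕ.^ e ℕ.* u)         ≡⟨ ℕₚ.*-assoc (3 ℕ.^ k) (3 ℕ.^ e) u ⟨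
    3 ℕ.^ k ℕ.* 3 ℕ.^ e ℕ.* u           ≡⟨ ≡.cong (ℕ._* u) (ℕₚ.^-distribˡ-+-* 3 k e) ⟨
    3 ℕ.^ (k ℕ.+ e) ℕ.* u               ∎) 3∤u)
    (≡.cong (k +⁺_) (≡.sym (v₃-abs w e u (≡.trans eq m≡) 3∤u)))
    where open ≡-Reasoning

-- Valuations under the hypotheses on s and t.

module _ {s t s′ t′ : ℤ} (a b : ℕ) (1≤a : 1 ℕ.≤ a) (s≡ : s ≡ + (3 ℕ.^ a) ℤ.* s′) (t≡ : t ≡ + (3 ℕ.^ b) ℤ.* t′)
         (3∤s′ : ¬ + 3 ∣ˢ s′) (3∤t′ : ¬ + 3 ∣ˢ t′) (b≡ : b ≡ 2 ℕ.* a ℕ.∸ 1) where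
  private module Cℤ = CubeMap +-*-rawRing
  open ≡-Reasoning

  3^+ : ∀ i j → + (3 ℕ.^ (i ℕ.+ j)) ≡ + (3 ℕ.^ i) ℤ.* + (3 ℕ.^ j)
  3^+ i j = ≡.trans (≡.cong +_ (ℕₚ.^-distribˡ-+-* 3 i j)) (ℤₚ.pos-* (3 ℕ.^ i) (3 ℕ.^ j))

  a+a≡1+b : a ℕ.+ a ≡ suc b
  a+a≡1+b = begin
    a ℕ.+ a                     ≡⟨ ≡.cong (a ℕ.+_) (ℕₚ.+-identityʳ a) ⟨
    2 ℕ.* a                     ≡⟨ ℕₚ.m+[n∸m]≡n (ℕₚ.≤-trans 1≤a (ℕₚ.m≤m+n a _)) ⟨
    suc (2 ℕ.* a ℕ.∸ 1)         ≡⟨ ≡.cong suc b≡ ⟨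
    suc b                       ∎

  -- As 2 a = b + 1, the square s² carries exactly one factor 3 more than t.
  s*s≡ : s ℤ.* s ≡ + (3 ℕ.^ b) ℤ.* (+ 3 ℤ.* (s′ ℤ.* s′))
  s*s≡ = begin
    s ℤ.* s                                              ≡⟨ ≡.cong₂ ℤ._*_ s≡ s≡ ⟩
    + (3 ℕ.^ a) ℤ.* s′ ℤ.* (+ (3 ℕ.^ a) ℤ.* s′)
      ≡⟨ solve 2 (λ x s → x :* s :* (x :* s) := x :* x :* (s :* s)) ≡.refl (+ (3 ℕ.^ a)) s′ ⟩
    + (3 ℕ.^ a) ℤ.* + (3 ℕ.^ a) ℤ.* (s′ ℤ.* s′)          ≡⟨ ≡.cong (ℤ._* (s′ ℤ.* s′)) (3^+ a a) ⟨
    + (3 ℕ.^ (a ℕ.+ a)) ℤ.* (s′ ℤ.* s′)                  ≡⟨ ≡.cong (λ i → + (3 ℕ.^ i) ℤ.* (s′ ℤ.* s′)) a+a≡1+b ⟩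
    + (3 ℕ.^ suc b) ℤ.* (s′ ℤ.* s′)                      ≡⟨ ≡.cong (ℤ._* (s′ ℤ.* s′)) (ℤₚ.pos-* 3 (3 ℕ.^ b)) ⟩
    + 3 ℤ.* + (3 ℕ.^ b) ℤ.* (s′ ℤ.* s′)
      ≡⟨ solve 3 (λ c x s → c :* x :* s := x :* (c :* s)) ≡.refl (+ 3) (+ (3 ℕ.^ b)) (s′ ℤ.* s′) ⟩
    + (3 ℕ.^ b) ℤ.* (+ 3 ℤ.* (s′ ℤ.* s′))                ∎
    where open ℤSolver.+-*-Solver

  s≢0 : s ≢ ℤ.0ℤ
  s≢0 s≡0 = 3∤s′ (≡.subst (+ 3 ∣ˢ_) (≡.sym (cancel≢0 s′ 3^a≢0 (≡.trans (≡.sym s≡) s≡0))) (divides ℤ.0ℤ ≡.refl))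
    where
    3^a≢0 : + (3 ℕ.^ a) ≢ ℤ.0ℤ
    3^a≢0 eq = ℕₚ.>⇒≢ (ℕₚ.m^n>0 3 a) (ℤₚ.+-injective eq)

  β : ℕ → ℤ
  β k = + (3 ℕ.^ (3 ℕ.^ k ℕ.* b))

  β-suc : ∀ k → β (suc k) ≡ β k ℤ.* (β k ℤ.* β k)
  β-suc k = begin
    + (3 ℕ.^ (3 ℕ.* 3 ℕ.^ k ℕ.* b))   ≡⟨ ≡.cong (λ i → + (3 ℕ.^ i)) (ℕₚ.*-assoc 3 (3 ℕ.^ k) b) ⟩
    + (3 ℕ.^ (B ℕ.+ (B ℕ.+ (B ℕ.+ 0)))) ≡⟨ ≡.cong (λ i → + (3 ℕ.^ (B ℕ.+ (B ℕ.+ i)))) (ℕₚ.+-identityʳ B) ⟩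
    + (3 ℕ.^ (B ℕ.+ (B ℕ.+ B)))       ≡⟨ ≡.trans (3^+ B (B ℕ.+ B)) (≡.cong (β k ℤ.*_) (3^+ B B)) ⟩
    β k ℤ.* (β k ℤ.* β k)             ∎
    where B = 3 ℕ.^ k ℕ.* b

  -- The invariant of the iteration: 3 ^ (3ᵏ b) is the common scale of σ² / 3 and τ, which makes σ²
  -- + 3 τ three times the scale times w + T. Only σ² is tracked, since the next σ² is σ² times the
  -- square of `sixth`; w may be divisible by 3, T may not.
  record Scaled (k : ℕ) : Set where
    field
      w T  : ℤ
      σ²≡  : Cℤ.σ k s t ℤ.* Cℤ.σ k s t ≡ β k ℤ.* (+ 3 ℤ.* w)
      τ≡   : Cℤ.τ k t ≡ β k ℤ.* T
      3∤T  : ¬ + 3 ∣ˢ T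

    sixth≡ : Cℤ.sixth k s t ≡ + (3 ℕ.^ (3 ℕ.^ k ℕ.* b ℕ.+ 1)) ℤ.* (w ℤ.+ T)
    sixth≡ = begin
      Cℤ.sixth k s t
        ≡⟨ ≡.cong₂ (λ u v → u ℤ.+ (v ℤ.+ (v ℤ.+ v))) σ²≡ τ≡ ⟩
      β k ℤ.* (+ 3 ℤ.* w) ℤ.+ (β k ℤ.* T ℤ.+ (β k ℤ.* T ℤ.+ β k ℤ.* T))
        ≡⟨ solve 3 (λ x w T → x :* (con (+ 3) :* w) :+ (x :* T :+ (x :* T :+ x :* T)) := x :* con (+ 3) :* (w :+ T))
             ≡.refl (β k) w T ⟩
      β k ℤ.* + 3 ℤ.* (w ℤ.+ T)
        ≡⟨ ≡.cong (ℤ._* (w ℤ.+ T)) (3^+ (3 ℕ.^ k ℕ.* b) 1) ⟨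
      + (3 ℕ.^ (3 ℕ.^ k ℕ.* b ℕ.+ 1)) ℤ.* (w ℤ.+ T) ∎
      where open ℤSolver.+-*-Solver

  open Scaled

  scaled-zero : Scaled 0
  scaled-zero = record
    { w = s′ ℤ.* s′ ; T = t′
    ; σ²≡ = ≡.trans s*s≡ (≡.cong (λ i → + (3 ℕ.^ i) ℤ.* (+ 3 ℤ.* (s′ ℤ.* s′))) (≡.sym (ℕₚ.*-identityˡ b)))
    ; τ≡  = ≡.trans t≡ (≡.cong (λ i → + (3 ℕ.^ i) ℤ.* t′) (≡.sym (ℕₚ.*-identityˡ b)))
    ; 3∤T = 3∤t′ }

  -- The new w is 9 w (w + T)², the two extra factors 3 coming from the square of `sixth`. So from k
  -- = 1 on, 3 divides w but not T, and w + T is prime to 3.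
  scaled-suc : ∀ k (d : Scaled k) → ∃[ d′ ] + 3 ∣ˢ w {suc k} d′
  scaled-suc k d = record
    { w = W ; T = T d ℤ.* (T d ℤ.* T d)
    ; σ²≡ = begin
        Cℤ.σ k s t ℤ.* Q ℤ.* (Cℤ.σ k s t ℤ.* Q)
          ≡⟨ solve 2 (λ x q → x :* q :* (x :* q) := x :* x :* (q :* q)) ≡.refl (Cℤ.σ k s t) Q ⟩
        Cℤ.σ k s t ℤ.* Cℤ.σ k s t ℤ.* (Q ℤ.* Q)
          ≡⟨ ≡.cong₂ (λ u v → u ℤ.* (v ℤ.* v)) (σ²≡ d)
               (≡.trans (sixth≡ d) (≡.cong (ℤ._* (w d ℤ.+ T d)) (3^+ (3 ℕ.^ k ℕ.* b) 1))) ⟩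
        β k ℤ.* (+ 3 ℤ.* w d) ℤ.* (β k ℤ.* + 3 ℤ.* (w d ℤ.+ T d) ℤ.* (β k ℤ.* + 3 ℤ.* (w d ℤ.+ T d)))
          ≡⟨ solve 3 (λ x w u → x :* (con (+ 3) :* w) :* (x :* con (+ 3) :* u :* (x :* con (+ 3) :* u)) :=
               x :* (x :* x) :* (con (+ 3) :* (con (+ 3) :* w :* (u :* u) :* con (+ 3)))) ≡.refl (β k) (w d) (w d ℤ.+ T d) ⟩
        β k ℤ.* (β k ℤ.* β k) ℤ.* (+ 3 ℤ.* W)
          ≡⟨ ≡.cong (ℤ._* (+ 3 ℤ.* W)) (β-suc k) ⟨
        β (suc k) ℤ.* (+ 3 ℤ.* W) ∎
    ; τ≡ = begin
        Cℤ.τ k t ℤ.* (Cℤ.τ k t ℤ.* Cℤ.τ k t)   ≡⟨ ≡.cong (λ u → u ℤ.* (u ℤ.* u)) (τ≡ d) ⟩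
        β k ℤ.* T d ℤ.* (β k ℤ.* T d ℤ.* (β k ℤ.* T d))
          ≡⟨ solve 2 (λ x T → x :* T :* (x :* T :* (x :* T)) := x :* (x :* x) :* (T :* (T :* T))) ≡.refl (β k) (T d) ⟩
        β k ℤ.* (β k ℤ.* β k) ℤ.* (T d ℤ.* (T d ℤ.* T d)) ≡⟨ ≡.cong (ℤ._* _) (β-suc k) ⟨
        β (suc k) ℤ.* (T d ℤ.* (T d ℤ.* T d))   ∎
    ; 3∤T = 3∤* (3∤T d) (3∤* (3∤T d) (3∤T d)) } , divides (+ 3 ℤ.* w d ℤ.* ((w d ℤ.+ T d) ℤ.* (w d ℤ.+ T d))) ≡.refl
    where
    open ℤSolver.+-*-Solver
    Q = Cℤ.sixth k s t
    W = + 3 ℤ.* w d ℤ.* ((w d ℤ.+ T d) ℤ.* (w d ℤ.+ T d)) ℤ.* + 3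

  scaled : ∀ k → Scaled k
  scaled zero    = scaled-zero
  scaled (suc k) = proj₁ (scaled-suc k (scaled k))

  -- Before the first step w + T is s′² + t′ with both summands prime to 3, so its valuation cannot
  -- be determined and remains in the formula.
  v₃-sixth-zero : v₃ (Cℤ.sixth 0 s t) ≡ (b ℕ.+ 1) +⁺ v₃ (s′ ℤ.^ 2 ℤ.+ t′)
  v₃-sixth-zero = v₃-scale (Cℤ.sixth 0 s t) (b ℕ.+ 1) (s′ ℤ.^ 2 ℤ.+ t′) (≡.trans (sixth≡ scaled-zero)
    (≡.cong₂ (λ i z → + (3 ℕ.^ (i ℕ.+ 1)) ℤ.* (z ℤ.+ t′)) (ℕₚ.*-identityˡ b) (≡.cong (s′ ℤ.*_) (≡.sym (ℤₚ.*-identityʳ s′)))))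

  v₃-sixth-suc : ∀ k → v₃ (Cℤ.sixth (suc k) s t) ≡ [ 3 ℕ.^ suc k ℕ.* b ℕ.+ 1 ]
  v₃-sixth-suc k = v₃-unit _ _ _ (sixth≡ d) λ 3∣ → 3∤T d (∣ℤ.∣m+n∣m⇒∣n 3∣ (proj₂ (scaled-suc k (scaled k))))
    where d = scaled (suc k)

  v₃-isobaric : ∀ d P → Isobaric d P → ¬ + 3 ∣ˢ P ⟨ + 3 , ℤ.- (+ 2) ⟩ → v₃ (P ⟨ s , t ⟩) ≡ [ b ℕ.* (d ℕ./ 2) ]
  v₃-isobaric d P iso 3∤P with parity d
  ... | m , inj₂ ≡.refl = contradiction (odd-isobaric m P (ℤ.- (+ 2)) iso (λ ()) ∣ℤ.∣-refl) 3∤P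
  ... | m , inj₁ ≡.refl
    -- The same expansion twice: at (3 , -2), where 3² = 1 · (3 · 3) gives β = 1 and S = 3, it shows
    -- that 3 does not divide the coefficient of tᵐ; at (s , t) it gives the valuation.
    with even-isobaric m P {+ 3} {ℤ.- (+ 2)} {ℤ.1ℤ} {+ 3} {ℤ.- (+ 2)} iso (λ ()) ≡.refl ≡.refl
       | even-isobaric m P {s} {t} {+ (3 ℕ.^ b)} {s′ ℤ.* s′} {t′} iso s≢0 s*s≡ t≡
  ... | w₀ , eq₀ | w₁ , eq₁ = v₃-unit (P ⟨ s , t ⟩) (b ℕ.* (m ℕ.* 2 ℕ./ 2)) (l ℤ.* t′ ℤ.^ m ℤ.+ + 3 ℤ.* w₁)
    (≡.trans eq₁ (≡.cong (ℤ._* (l ℤ.* t′ ℤ.^ m ℤ.+ + 3 ℤ.* w₁)) (≡.trans (power m)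
      (≡.cong (λ i → + (3 ℕ.^ (b ℕ.* i))) (≡.sym (m*n/n≡m m 2))))))
    (3∤+3* w₁ (3∤* 3∤l (3∤^ m 3∤t′)))
    where
    l = lowestCoefficient m P
    3∤l : ¬ + 3 ∣ˢ l
    3∤l 3∣l = 3∤P (≡.subst (+ 3 ∣ˢ_) (≡.sym eq₀) (∣ℤ.∣n⇒∣m*n (ℤ.1ℤ ℤ.^ m)
      (∣ℤ.∣m∣n⇒∣m+n (∣ℤ.∣m⇒∣m*n _ 3∣l) (∣ℤ.∣m⇒∣m*n w₀ ∣ℤ.∣-refl))))
    power : ∀ m → (+ (3 ℕ.^ b)) ℤ.^ m ≡ + (3 ℕ.^ (b ℕ.* m))
    power zero    = ≡.cong (λ i → + (3 ℕ.^ i)) (≡.sym (ℕₚ.*-zeroʳ b))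
    power (suc m) = begin
      + (3 ℕ.^ b) ℤ.* (+ (3 ℕ.^ b)) ℤ.^ m          ≡⟨ ≡.cong (+ (3 ℕ.^ b) ℤ.*_) (power m) ⟩
      + (3 ℕ.^ b) ℤ.* + (3 ℕ.^ (b ℕ.* m))        ≡⟨ 3^+ b (b ℕ.* m) ⟨
      + (3 ℕ.^ (b ℕ.+ b ℕ.* m))                  ≡⟨ ≡.cong (λ i → + (3 ℕ.^ i)) (ℕₚ.*-suc b m) ⟨
      + (3 ℕ.^ (b ℕ.* suc m))                    ∎

-- Either n is odd, and (xⁿ − 1) / (x − 1) is used, or n = 2 · 3ᵉ · u with
-- 3 ∤ u and u > 1, and (xⁿ − 1) / (x ^ (2 · 3ᵉ) − 1) is used.
coprimeGeometric : ∀ n → 2 ℕ.≤ n → (∀ h → n ≢ 2 ℕ.* 3 ℕ.^ h) →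
  ∃[ k ] ∃[ p ] n ≡ k ℕ.* p × 1 ℕ.≤ k × 1 ℕ.< p × ¬ + 3 ∣ˢ value (geometric k p) (+ 2)
coprimeGeometric n 2≤n n≢ with parity n
... | q , inj₂ ≡.refl = 1 , n , ≡.sym (ℕₚ.*-identityˡ n) , s≤s z≤n , 2≤n , 3∤geometric-odd q
... | zero , inj₁ ≡.refl = contradiction 2≤n λ ()
... | q@(suc _) , inj₁ ≡.refl with extract-3s q (s≤s z≤n)
... | e , zero , q≡ , 3∤u = contradiction (3 ∣ℕ.∣0) 3∤u
... | e , suc zero , q≡ , 3∤u = contradiction
  (≡.trans (ℕₚ.*-comm q 2) (≡.cong (2 ℕ.*_) (≡.trans q≡ (ℕₚ.*-identityʳ (3 ℕ.^ e))))) (n≢ e)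
... | e , u@(suc (suc _)) , q≡ , 3∤u = 2 ℕ.* 3 ℕ.^ e , u ,
  ≡.trans (ℕₚ.*-comm q 2) (≡.trans (≡.cong (2 ℕ.*_) q≡) (≡.sym (ℕₚ.*-assoc 2 (3 ℕ.^ e) u))) ,
  ℕₚ.≤-trans (ℕₚ.m^n>0 3 e) (ℕₚ.m≤m+n _ _) , s≤s (s≤s z≤n) , 3∤geometric-even (3 ℕ.^ e) 3∤u

2*3^[1+k]≡3^k*6 : ∀ k → 2 ℕ.* 3 ℕ.^ suc k ≡ 3 ℕ.^ k ℕ.* 6
2*3^[1+k]≡3^k*6 k = ≡.trans (≡.sym (ℕₚ.*-assoc 2 3 (3 ℕ.^ k))) (ℕₚ.*-comm 6 (3 ℕ.^ k))

open import Data.Nat.Base using (_+_; _*_; _∸_; _^_; _/_; _≤_)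

theorem18 : ∀ {c ℓ₁ ℓ₂} (K : HeytingField c ℓ₁ ℓ₂) → CharacteristicZero K →
    (ω : ℕ → HeytingField.Carrier K) →
    (∀ n → 1 ≤ n → IsPrimitiveRoot K n (ω n)) →
    (P : ℕ → RawRing.Carrier ℤ[s,t]) → IsLucasAtoms K ω P →
    (s t s′ t′ : ℤ) (a b : ℕ) → 1 ≤ a → 1 ≤ b →
    s ≡ (+ (3 ^ a)) ℤ.* s′ → t ≡ (+ (3 ^ b)) ℤ.* t′ →
    ¬ ((+ 3) ∣ (s′ ℤ.* t′)) → b ≡ 2 * a ∸ 1 →
    ∀ n → 2 ≤ n →
    (n ≡ 2 → v₃ (P n ⟨ s , t ⟩) ≡ [ a ]) ×
    (n ≡ 6 → v₃ (P n ⟨ s , t ⟩) ≡ (b + 1) +⁺ v₃ ((s′ ℤ.^ 2) ℤ.+ t′)) ×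
    (∀ h → 2 ≤ h → n ≡ 2 * 3 ^ h → v₃ (P n ⟨ s , t ⟩) ≡ [ 3 ^ (h ∸ 1) * b + 1 ]) ×
    (n ≢ 2 → n ≢ 6 → (∀ h → 2 ≤ h → n ≢ 2 * 3 ^ h) →
    v₃ (P n ⟨ s , t ⟩) ≡ [ b * (φ n / 2) ])
theorem18 K char0 ω prim P atoms s t s′ t′ a b 1≤a 1≤b s≡ t≡ 3∤s′t′ b≡ n 2≤n =
  (λ n≡2 → ≡.trans (≡.cong v₃ (A.value-second n≡2 s t)) (v₃-unit s a s′ s≡ 3∤s′)) ,
  (λ n≡6 → ≡.trans (≡.cong v₃ (sixth 0 n≡6)) (v₃-sixth-zero a b 1≤a s≡ t≡ 3∤s′ 3∤t′ b≡)) ,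
  (λ { (suc zero) (s≤s ()) _
     -- For h = k + 2 the number n is 3 ^ (h - 1) · 6, so the iteration stands at h - 1 = `suc k`.
     ; (suc (suc k)) _ n≡ → ≡.trans (≡.cong v₃ (sixth (suc k) (≡.trans n≡ (2*3^[1+k]≡3^k*6 (suc k)))))
         (v₃-sixth-suc a b 1≤a s≡ t≡ 3∤s′ 3∤t′ b≡ k) }) ,
  λ n≢2 n≢6 n≢ → v₃-isobaric a b 1≤a s≡ t≡ 3∤s′ 3∤t′ b≡ (φ n) (P n) A.isobaric
    -- The three excluded cases together are n = 2 · 3ʰ with h = 0, h = 1 and h ≥ 2.
    (3∤P (λ { zero → n≢2 ; (suc zero) → n≢6 ; h@(suc (suc _)) → n≢ h (s≤s (s≤s z≤n)) }))
  where
  1≤n : 1 ≤ n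
  1≤n = ℕₚ.<⇒≤ 2≤n

  module A = LucasAtom K char0 1≤n (ω n) (prim n 1≤n) (P n) (IsLucasAtoms.atom atoms n 2≤n)

  3∤s′ : ¬ + 3 ∣ˢ s′
  3∤s′ 3∣s′ = 3∤s′t′ (∣ℤ.∣⇒∣ᵤ (∣ℤ.∣m⇒∣m*n t′ 3∣s′))

  3∤t′ : ¬ + 3 ∣ˢ t′
  3∤t′ 3∣t′ = 3∤s′t′ (∣ℤ.∣⇒∣ᵤ (∣ℤ.∣n⇒∣m*n s′ 3∣t′))

  sixth : ∀ k → n ≡ 3 ^ k * 6 → P n ⟨ s , t ⟩ ≡ CubeMap.sixth +-*-rawRing k s t
  sixth k n≡ = A.value-sixth k n≡ (≡.trans (≡.cong φ n≡) (φ[3^k*6] k)) s t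

  3∤P : (∀ h → n ≢ 2 * 3 ^ h) → ¬ + 3 ∣ˢ P n ⟨ + 3 , ℤ.- (+ 2) ⟩
  3∤P n≢ 3∣P with coprimeGeometric n 2≤n n≢
  ... | k , p , n≡kp , 1≤k , 1<p , 3∤g = 3∤g (∣ℤ.∣-trans 3∣P (A.value-∣-geometric n≡kp 1≤k 1<p))
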